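{- Let $\mathcal{G}=(V,E)$ be a connected hypergraph with $n\ge 3$ vertices such that $\mathcal{G}$ contains at least one pair of nonadjacent vertices and $d_{\max}\le cr(\mathcal{G})$. Then $\lambda_2(L_{\mathcal{G}})\le\kappa_W(\mathcal{G})$.
   Context: A hypergraph $\mathcal{G}=(V,E)$ has a finite vertex set $V$ and a set $E$ of subsets of $V$ (edges), each of cardinality at least $2$. Two distinct vertices $i,j$ are adjacent ($i\sim j$) if some edge contains both. The degree $d_i$ is the number of edges containing $i$, $d_{\max}=\max_i d_i$, and the co-rank $cr(\mathcal{G})$ is the minimum cardinality of an edge. The adjacency matrix $A_{\mathcal{G}}$ has $(A_{\mathcal{G}})_{ij}=\sum_{e\in E,\, i,j\in e}\frac{1}{|e|-1}$ for $i\ne j$ and zero diagonal; the Laplacian is $L_{\mathcal{G}}=D_{\mathcal{G}}-A_{\mathcal{G}}$ with $D_{\mathcal{G}}=\mathrm{diag}(d_i)$, i.e. $(L_{\mathcal{G}}f)(i)=\sum_{j\sim i}\sum_{e\ni i,j}\frac{1}{|e|-1}(f(i)-f(j))$. Its eigenvalues are ordered $\lambda_1(L_{\mathcal{G}})\le\lambda_2(L_{\mathcal{G}})\le\dots\le\lambda_n(L_{\mathcal{G}})$. Weak deletion of a set of vertices removes those vertices from $V$ and from every edge containing them. A weak vertex cut is a set of vertices whose weak deletion increases the number of connected components; $\kappa_W(\mathcal{G})$ is the minimum size of a weak vertex cut. -}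

module Defs where

open import Algebra.Apartness.Bundles using (HeytingField)
open import Algebra.Bundles using (CommutativeRing; Semiring)
import Algebra.Definitions.RawSemiring as RawSemiringDefinitions
open import Data.Fin.Base as Fin using (Fin; zero; suc; toℕ; punchIn)
import Data.Fin.Properties as Fin
open import Data.Fin.Subset using (Subset; _∈_; _─_; ∣_∣; ⊤)
open import Data.Fin.Subset.Properties using (_∈?_)
open import Data.List.Base as List using (List; length; filter; allFin; foldr)
open import Data.List.Extrema.Nat using (max; min)
open import Data.List.Relation.Unary.All using (All)
open import Data.List.Relation.Unary.Any using (Any)
open import Data.List.Relation.Unary.Unique.Propositional using (Unique)
open import Data.Nat.Base as ℕ using (ℕ; zero; suc; _∸_)
open import Data.Product.Base using (∃-syntax; _×_; proj₁)
open import Data.Sum.Base using (_⊎_)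
open import Function.Definitions using (StrictlySurjective)
open import Level using (Level; _⊔_) renaming (suc to lsuc)
open import Relation.Binary.Construct.Closure.ReflexiveTransitive using (Star)
open import Relation.Binary.Core using (Rel)
open import Relation.Binary.PropositionalEquality.Core using (_≡_; _≢_)
open import Relation.Binary.Structures using (IsStrictPartialOrder)
open import Relation.Nullary.Decidable.Core using (yes; no; _×-dec_)
open import Relation.Nullary.Negation.Core using (¬_)

private variable
  n : ℕ

-- The real numbers, axiomatised as a Cauchy-complete Archimedean ordered field.
-- The order is not assumed decidable, so that Cauchy and Dedekind reals are
-- models constructively; classically the model is unique up to isomorphism.
record Reals (c ℓ₁ ℓ₂ : Level) : Set (lsuc (c ⊔ ℓ₁ ⊔ ℓ₂)) where
  field
    heytingField : HeytingField c ℓ₁ ℓ₂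

  open HeytingField heytingField public hiding (zero)

  commutativeRing : CommutativeRing c ℓ₁
  commutativeRing = record { isCommutativeRing = isCommutativeRing }

  open CommutativeRing commutativeRing public using (semiring)
  open Semiring semiring public using (rawSemiring)
  open RawSemiringDefinitions rawSemiring using () renaming (_×_ to _·_)

  fromℕ : ℕ → Carrier
  fromℕ k = k · 1#

  infix 4 _<_ _≤_
  field
    _<_                  : Rel Carrier ℓ₂
    isStrictPartialOrder : IsStrictPartialOrder _≈_ _<_
    #⇒<⊎>                : ∀ {x y} → x # y → x < y ⊎ y < x
    <⇒#                  : ∀ {x y} → x < y → x # y
    0<1                  : 0# < 1#
    +-monoˡ-<            : ∀ z {x y} → x < y → x + z < y + z
    *-pos                : ∀ {x y} → 0# < x → 0# < y → 0# < x * y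
    archimedean          : ∀ x → ∃[ k ] x < fromℕ k
    -- The hypothesis says |x p − x q| < 1/(k+1) for p, q ≥ modulus k.
    complete             : (x : ℕ → Carrier) (modulus : ℕ → ℕ) →
      (∀ k p q → modulus k ℕ.≤ p → modulus k ℕ.≤ q →
        fromℕ (suc k) * (x p - x q) < 1#) →
      ∃[ l ] ∀ k → ∃[ N ] ∀ p → N ℕ.≤ p →
        fromℕ (suc k) * (x p - l) < 1# × fromℕ (suc k) * (l - x p) < 1#

  _≤_ : Rel Carrier ℓ₂
  x ≤ y = ¬ (y < x)

  open IsStrictPartialOrder isStrictPartialOrder public
    using () renaming (trans to <-trans; <-respˡ-≈ to <-respˡ; <-respʳ-≈ to <-respʳ)

  0<fromℕ : ∀ k → 0# < fromℕ (suc k)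
  0<fromℕ zero    = <-respʳ (sym (+-identityʳ 1#)) 0<1
  0<fromℕ (suc k) = <-trans (0<fromℕ k)
    (<-respˡ (+-identityˡ _) (+-monoˡ-< (fromℕ (suc k)) 0<1))

  -- 1/k for k > 0; the value at 0 is never used.  `#⇒invertible` inverts
  -- k − 0, which is k.
  1/ℕ : ℕ → Carrier
  1/ℕ zero    = 0#
  1/ℕ (suc k) = proj₁ (#⇒invertible {fromℕ (suc k)} {0#} (#-sym (<⇒# (0<fromℕ k))))

-- A vertex set together with a family of vertex sets.  Weak deletion may
-- leave edges with fewer than two vertices or repeated edges; neither
-- influences adjacency, hence connectivity.
record SetSystem (n : ℕ) : Set where
  constructor mkSetSystem
  field
    vertices : Subset n
    edges    : List (Subset n)

record Hypergraph (n : ℕ) : Set where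
  field
    edges      : List (Subset n)
    distinct   : Unique edges
    edgeSize≥2 : All (λ e → 2 ℕ.≤ ∣ e ∣) edges

  setSystem : SetSystem n
  setSystem = mkSetSystem ⊤ edges

module _ (H : SetSystem n) where
  open SetSystem H

  Adjacent : Rel (Fin n) _
  Adjacent i j = i ≢ j × Any (λ e → i ∈ e × j ∈ e) edges

  Path : Rel (Fin n) _
  Path = Star Adjacent

  Vertex : Set
  Vertex = ∃[ i ] i ∈ vertices

  -- H has exactly c connected components: its vertices can be labelled
  -- surjectively by Fin c so that the label classes are the path classes.
  record HasComponents (c : ℕ) : Set where
    field
      component  : Vertex → Fin c
      surjective : StrictlySurjective _≡_ component
      path⇒≡     : ∀ u v → Path (proj₁ u) (proj₁ v) → component u ≡ component v
      ≡⇒path     : ∀ u v → component u ≡ component v → Path (proj₁ u) (proj₁ v)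

weakDelete : Subset n → SetSystem n → SetSystem n
weakDelete S (mkSetSystem V E) = mkSetSystem (V ─ S) (List.map (_─ S) E)

module _ (G : Hypergraph n) where
  open Hypergraph G

  Connected : Set
  Connected = ∀ i j → Path setSystem i j

  HasNonadjacentPair : Set
  HasNonadjacentPair = ∃[ i ] ∃[ j ] i ≢ j × ¬ Adjacent setSystem i j

  degree : Fin n → ℕ
  degree i = length (filter (i ∈?_) edges)

  maxDegree : ℕ
  maxDegree = max 0 (List.map degree (allFin n))

  -- No edge has more than n vertices, so the default value n is irrelevant
  -- as soon as there is an edge.
  coRank : ℕ
  coRank = min n (List.map ∣_∣ edges)

  IsWeakCut : Subset n → Set
  IsWeakCut S = ∃[ c ] ∃[ c′ ]
    HasComponents setSystem c × HasComponents (weakDelete S setSystem) c′ × c ℕ.< c′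

  IsWeakConnectivity : ℕ → Set
  IsWeakConnectivity κ =
    (∃[ S ] IsWeakCut S × ∣ S ∣ ≡ κ) × (∀ S → IsWeakCut S → κ ℕ.≤ ∣ S ∣)

module _ {c ℓ₁ ℓ₂} (ℝ : Reals c ℓ₁ ℓ₂) where
  open Reals ℝ
  open RawSemiringDefinitions rawSemiring using (sum; product; _^_)

  Matrix : ℕ → Set c
  Matrix n = Fin n → Fin n → Carrier

  diagonal : (Fin n → Carrier) → Matrix n
  diagonal d i j with i Fin.≟ j
  ... | yes _ = d i
  ... | no  _ = 0#

  infixl 6 _⊖_
  _⊖_ : Matrix n → Matrix n → Matrix n
  (M ⊖ N) i j = M i j - N i j

  -- Laplace expansion along the first row.
  det : Matrix n → Carrier
  det {zero}  M = 1#
  det {suc n} M = sum λ j →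
    (- 1#) ^ toℕ j * M zero j * det (λ k l → M (suc k) (punchIn j l))

  charPoly : Matrix n → Carrier → Carrier
  charPoly M x = det (diagonal (λ _ → x) ⊖ M)

  -- ev lists the eigenvalues of M with multiplicity (the roots of its
  -- characteristic polynomial) in nondecreasing order.  As ℝ is infinite,
  -- equality of polynomial functions is equality of polynomials.
  record IsOrderedSpectrum (M : Matrix n) (ev : Fin n → Carrier) : Set (c ⊔ ℓ₁ ⊔ ℓ₂) where
    field
      ordered : ∀ {i j} → i Fin.≤ j → ev i ≤ ev j
      roots   : ∀ x → charPoly M x ≈ product (λ i → x - ev i)

  module _ (G : Hypergraph n) where
    open Hypergraph G

    adjacencyMatrix : Matrix n
    adjacencyMatrix i j with i Fin.≟ j
    ... | yes _ = 0#
    ... | no  _ = foldr (λ e s → 1/ℕ (∣ e ∣ ∸ 1) + s) 0#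
                    (filter (λ e → (i ∈? e) ×-dec (j ∈? e)) edges)

    degreeMatrix : Matrix n
    degreeMatrix = diagonal (λ i → fromℕ (degree G i))

    laplacian : Matrix n
    laplacian = degreeMatrix ⊖ adjacencyMatrix

{-# OPTIONS --safe #-}
-- Let S be a minimum weak cut, let X be a component of its complement and Y
-- the rest of the complement.  By minimality every s ∈ S has an edge meeting X
-- and an edge meeting Y, and no edge meets both; so a vertex i ∉ S shares at
-- most d_s − 1 ≤ cr − 1 edges with s, and A_is ≤ 1.  Hence f = |Y| 1_X − |X| 1_Y
-- satisfies ⟨f, L f⟩ ≤ |S| ⟨f, f⟩, while f ⊥ 1.
--
-- Conversely, if λ₂ > |S| ≥ 0, then ⟨f, L f⟩ ≥ λ₂ ⟨f, f⟩ for all f ⊥ 1.  Only the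
-- characteristic polynomial is known to split, so this is derived from the
-- Cayley–Hamilton theorem Π (λᵢ − L) = 0: as ker L is spanned by 1, the factors
-- with i ≥ 2 already annihilate f, and peeling them off one at a time
-- splits f into orthogonal eigenvectors.
--
-- The order on ℝ is not decidable, but _≤_ and _≈_ are stable under double
-- negation, so case distinctions are available when proving them.
module Submission where

open import Defs
open import Algebra.Bundles using (CommutativeRing)
import Algebra.Apartness.Properties.HeytingCommutativeRing as HeytingCommutativeRingProperties
import Algebra.Definitions.RawSemiring as RawSemiringDefinitions
import Algebra.Properties.Ring as RingProperties
import Algebra.Properties.Semiring.Mult.TCOptimised as SemiringMult
import Algebra.Properties.Semiring.Sum as SemiringSum
import Algebra.Solver.Ring as RingSolver
open import Algebra.Solver.Ring.AlmostCommutativeRing using (_-Raw-AlmostCommutative⟶_; fromCommutativeRing)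
open import Data.Bool.Base using (if_then_else_)
open import Data.Empty using (⊥)
open import Data.Fin.Base as Fin using (Fin; zero; suc; punchIn; punchOut; toℕ; inject₁; fromℕ<)
import Data.Fin.Properties as Fin
open import Data.Fin.Subset using (Subset; _∈_; _∉_; _─_; ∣_∣; ⊤; inside; outside) renaming (_-_ to _∖_)
open import Data.Fin.Subset.Properties using (_∈?_; ∈⊤; x∈⁅x⁆; x∈p∧x∉q⇒x∈p─q; p─q⊆p; x∈p⇒∣p-x∣<∣p∣; x∈p∧x≢y⇒x∈p-y)
open import Data.Integer.Base as ℤ using (ℤ; +_; -[1+_])
import Data.Integer.Properties as ℤ
open import Data.List.Base as List using (List; []; _∷_; length; filter; foldr)
open import Data.List.Extrema.Nat using (min≤xs; xs≤max)
open import Data.List.Membership.Propositional using (find; lose) renaming (_∈_ to _∈ˡ_)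
open import Data.List.Membership.Propositional.Properties using (∈-allFin; ∈-map⁺)
import Data.List.Properties as List
open import Data.List.Relation.Unary.All as All using (All; []; _∷_)
import Data.List.Relation.Unary.All.Properties as All
open import Data.List.Relation.Unary.Any as Any using (Any; here; there)
import Data.List.Relation.Unary.Any.Properties as Any
open import Data.Maybe.Base using (Maybe; just; nothing)
open import Data.Nat.Base as ℕ using (ℕ; zero; suc; z≤n; s≤s; _∸_)
import Data.Nat.Properties as ℕ
open import Data.Product.Base using (_,_; proj₁; proj₂; _×_; ∃-syntax)
import Data.Sign.Base as Sign
open import Data.Sum.Base using (_⊎_; inj₁; inj₂)
open import Data.Unit.Polymorphic.Base using (tt) renaming (⊤ to 𝟙)
open import Data.Vec.Base as Vec using (_∷_; here; there)
open import Data.Vec.Functional using (removeAt)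
open import Function.Base using (_∘_)
open import Level using (Level; _⊔_)
open import Relation.Binary.Construct.Closure.ReflexiveTransitive using (ε; _◅_; _◅◅_; reverse)
open import Relation.Binary.Core using (Rel)
open import Relation.Binary.Definitions using (tri<; tri≈; tri>)
open import Relation.Binary.PropositionalEquality.Core as ≡ using (_≡_; _≢_)
import Relation.Binary.Reasoning.Setoid as SetoidReasoning
open import Relation.Binary.Structures using (IsEquivalence; IsStrictPartialOrder)
open import Relation.Nullary.Decidable.Core using (Dec; yes; no; does; _×-dec_; ¬¬-excluded-middle; decidable-stable)
open import Relation.Nullary.Negation.Core using (¬_; contradiction)
open import Relation.Unary using (Pred; Decidable)

private variable
  d m n : ℕ

-- Components and minimum cuts

-- The hypothesis d_max ≤ cr enters through A_is alone: at most cr - 1 common edges, each of weight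
-- at most 1/(cr - 1), add up to at most 1. On the spectral side polynomials occur only as functions
-- of a real variable, so a matrix cannot simply be substituted for x in det(x - L). Instead,
-- Cramer's rule writes det(x - L) f as the adjugate of x - L applied to (x - L) f, and the factors
-- x - λᵢ are divided off one at a time. Each division lowers the degree of the adjugate entries by
-- one and restricts the identity to vectors in the image of λᵢ - L. The entries have degree less
-- than n, so after n divisions they are zero, which says that the product of all λᵢ - L vanishes.
-- No eigenvector other than the constant one is available beforehand; the others are produced as
-- images f ↦ Π (λᵢ - L) f over all factors but one.

∈─⇒∉ : {x : Fin n} {p q : Subset n} → x ∈ p ─ q → x ∉ q
∈─⇒∉ {x = zero}  {_ ∷ p} {outside ∷ q} _           ()
∈─⇒∉ {x = suc x} {_ ∷ p} {_ ∷ q}       (there x∈) (there x∈q) = ∈─⇒∉ x∈ x∈q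

length-filter-≤ : ∀ {a p q} {A : Set a} {P : Pred A p} {Q : Pred A q} (P? : Decidable P) (Q? : Decidable Q) →
  (∀ {x} → P x → Q x) → ∀ xs → length (filter P? xs) ℕ.≤ length (filter Q? xs)
length-filter-≤ P? Q? P⇒Q [] = z≤n
length-filter-≤ P? Q? P⇒Q (x ∷ xs) with P? x | Q? x
... | yes px | yes _  = s≤s (length-filter-≤ P? Q? P⇒Q xs)
... | yes px | no ¬qx = contradiction (P⇒Q px) ¬qx
... | no _   | yes _  = ℕ.m≤n⇒m≤1+n (length-filter-≤ P? Q? P⇒Q xs)
... | no _   | no _   = length-filter-≤ P? Q? P⇒Q xs

length-filter-< : ∀ {a p q} {A : Set a} {P : Pred A p} {Q : Pred A q} (P? : Decidable P) (Q? : Decidable Q) →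
  (∀ {x} → P x → Q x) → ∀ {x xs} → x ∈ˡ xs → Q x → ¬ P x → length (filter P? xs) ℕ.< length (filter Q? xs)
length-filter-< P? Q? P⇒Q {x} {_ ∷ xs} (here ≡.refl) qx ¬px with P? x | Q? x
... | yes px | _      = contradiction px ¬px
... | no _   | no ¬qx = contradiction qx ¬qx
... | no _   | yes _  = s≤s (length-filter-≤ P? Q? P⇒Q xs)
length-filter-< P? Q? P⇒Q {xs = y ∷ xs} (there x∈xs) qx ¬px with P? y | Q? y
... | yes py | yes _  = s≤s (length-filter-< P? Q? P⇒Q x∈xs qx ¬px)
... | yes py | no ¬qy = contradiction (P⇒Q py) ¬qy
... | no _   | yes _  = ℕ.m≤n⇒m≤1+n (length-filter-< P? Q? P⇒Q x∈xs qx ¬px)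
... | no _   | no _   = length-filter-< P? Q? P⇒Q x∈xs qx ¬px

-- Double negation commutes with finite conjunctions, so finitely many instances of excluded middle
-- may be assumed together while a negation is being proved.
¬¬-∀-Fin : ∀ {p} {P : Fin n → Set p} → (∀ i → ¬ ¬ P i) → ¬ ¬ (∀ i → P i)
¬¬-∀-Fin {zero}  ¬¬p k = k λ ()
¬¬-∀-Fin {suc n} ¬¬p k = ¬¬p zero λ p₀ → ¬¬-∀-Fin (¬¬p ∘ suc) λ p → k λ { zero → p₀ ; (suc i) → p i }

record Classes {n} (V : Fin n → Set) (R : Rel (Fin n) _) : Set where
  field
    count      : ℕ
    class      : ∃[ i ] V i → Fin count
    surjective : ∀ y → ∃[ u ] class u ≡ y
    R⇒≡        : ∀ u v → R (proj₁ u) (proj₁ v) → class u ≡ class v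
    ≡⇒R        : ∀ u v → class u ≡ class v → R (proj₁ u) (proj₁ v)

-- Induction on `n`: vertex `zero`, if it lies in `V`, joins the class of a related later vertex or
-- else opens a new class. Allowing an arbitrary equivalence and a subset `V` lets both be
-- restricted along `suc`.
classes : (V : Fin n → Set) (R : Rel (Fin n) _) → IsEquivalence R →
  (∀ i → Dec (V i)) → (∀ i j → Dec (R i j)) → Classes V R
classes {zero} V R eqv V? R? = record
  { count = 0 ; class = λ { (() , _) } ; surjective = λ () ; R⇒≡ = λ { (() , _) } ; ≡⇒R = λ { (() , _) } }
classes {suc n} V R eqv V? R? = extend (V? zero)
  where
  open IsEquivalence eqv
  rest : Classes (V ∘ suc) (λ i j → R (suc i) (suc j))
  rest = classes (V ∘ suc) (λ i j → R (suc i) (suc j))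
    (record { refl = refl ; sym = sym ; trans = trans }) (V? ∘ suc) (λ i j → R? (suc i) (suc j))
  open Classes rest

  extend-old : V zero → (∃[ i ] V (suc i) × R zero (suc i)) → Classes V R
  extend-old v₀ (i , vi , r) = record
    { count = count ; class = class′ ; surjective = surjective′ ; R⇒≡ = R⇒≡′ ; ≡⇒R = ≡⇒R′ }
    where
    class′ : ∃[ i ] V i → Fin count
    class′ (zero  , _) = class (i , vi)
    class′ (suc j , v) = class (j , v)
    surjective′ : ∀ y → ∃[ u ] class′ u ≡ y
    surjective′ y with surjective y
    ... | (j , v) , eq = (suc j , v) , eq
    R⇒≡′ : ∀ u v → R (proj₁ u) (proj₁ v) → class′ u ≡ class′ v
    R⇒≡′ (zero  , _) (zero  , _) _  = ≡.refl
    R⇒≡′ (zero  , _) (suc j , v) r′ = R⇒≡ (i , vi) (j , v) (trans (sym r) r′)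
    R⇒≡′ (suc j , v) (zero  , _) r′ = R⇒≡ (j , v) (i , vi) (trans r′ r)
    R⇒≡′ (suc j , v) (suc k , w) r′ = R⇒≡ (j , v) (k , w) r′
    ≡⇒R′ : ∀ u v → class′ u ≡ class′ v → R (proj₁ u) (proj₁ v)
    ≡⇒R′ (zero  , _) (zero  , _) _  = refl
    ≡⇒R′ (zero  , _) (suc j , v) eq = trans r (≡⇒R (i , vi) (j , v) eq)
    ≡⇒R′ (suc j , v) (zero  , _) eq = trans (≡⇒R (j , v) (i , vi) eq) (sym r)
    ≡⇒R′ (suc j , v) (suc k , w) eq = ≡⇒R (j , v) (k , w) eq

  extend-new : V zero → ¬ (∃[ i ] V (suc i) × R zero (suc i)) → Classes V R
  extend-new v₀ isolated = record
    { count = suc count ; class = class′ ; surjective = surjective′ ; R⇒≡ = R⇒≡′ ; ≡⇒R = ≡⇒R′ }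
    where
    class′ : ∃[ i ] V i → Fin (suc count)
    class′ (zero  , _) = zero
    class′ (suc j , v) = suc (class (j , v))
    surjective′ : ∀ y → ∃[ u ] class′ u ≡ y
    surjective′ zero = (zero , v₀) , ≡.refl
    surjective′ (suc y) with surjective y
    ... | (j , v) , eq = (suc j , v) , ≡.cong suc eq
    R⇒≡′ : ∀ u v → R (proj₁ u) (proj₁ v) → class′ u ≡ class′ v
    R⇒≡′ (zero  , _) (zero  , _) _  = ≡.refl
    R⇒≡′ (zero  , _) (suc j , v) r′ = contradiction (j , v , r′) isolated
    R⇒≡′ (suc j , v) (zero  , _) r′ = contradiction (j , v , sym r′) isolated
    R⇒≡′ (suc j , v) (suc k , w) r′ = ≡.cong suc (R⇒≡ (j , v) (k , w) r′)
    ≡⇒R′ : ∀ u v → class′ u ≡ class′ v → R (proj₁ u) (proj₁ v)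
    ≡⇒R′ (zero  , _) (zero  , _) _  = refl
    ≡⇒R′ (suc j , v) (suc k , w) eq = ≡⇒R (j , v) (k , w) (Fin.suc-injective eq)

  extend : Dec (V zero) → Classes V R
  extend (yes v₀) with Fin.any? (λ i → V? (suc i) ×-dec R? zero (suc i))
  ... | yes related = extend-old v₀ related
  ... | no isolated = extend-new v₀ isolated
  extend (no ¬v₀) = record
    { count = count
    ; class = λ { (zero , v) → contradiction v ¬v₀ ; (suc j , v) → class (j , v) }
    ; surjective = λ y → let (j , v) , eq = surjective y in (suc j , v) , eq
    ; R⇒≡ = λ { (zero , v) _ _ → contradiction v ¬v₀
              ; (suc _ , _) (zero , v) _ → contradiction v ¬v₀
              ; (suc j , v) (suc k , w) → R⇒≡ (j , v) (k , w) }
    ; ≡⇒R = λ { (zero , v) _ _ → contradiction v ¬v₀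
              ; (suc _ , _) (zero , v) _ → contradiction v ¬v₀
              ; (suc j , v) (suc k , w) → ≡⇒R (j , v) (k , w) }
    }

module _ (H : SetSystem n) where

  Adjacent-sym : ∀ {i j} → Adjacent H i j → Adjacent H j i
  Adjacent-sym (i≢j , e) = i≢j ∘ ≡.sym , Any.map (λ (i∈e , j∈e) → j∈e , i∈e) e

  Path-isEquivalence : IsEquivalence (Path H)
  Path-isEquivalence = record { refl = ε ; sym = reverse Adjacent-sym ; trans = _◅◅_ }

  -- `Path` is a reflexive transitive closure with no decision procedure at hand, so it is decided
  -- only under a double negation. That suffices, because component counts of deleted systems serve
  -- only to refute something.
  ¬¬-hasComponents : ¬ ¬ (∃[ c ] HasComponents H c)
  ¬¬-hasComponents k = ¬¬-∀-Fin (λ i → ¬¬-∀-Fin λ j → ¬¬-excluded-middle) λ path? →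
    let open Classes (classes (_∈ SetSystem.vertices H) (Path H) Path-isEquivalence (_∈? _) path?) in
    k (count , record { component = class ; surjective = surjective ; path⇒≡ = R⇒≡ ; ≡⇒path = ≡⇒R })

-- Separations and the edges at a minimum weak cut

data Side : Set where
  cut left right : Side

_≟ˢ_ : (s t : Side) → Dec (s ≡ t)
cut   ≟ˢ cut   = yes ≡.refl
cut   ≟ˢ left  = no λ ()
cut   ≟ˢ right = no λ ()
left  ≟ˢ cut   = no λ ()
left  ≟ˢ left  = yes ≡.refl
left  ≟ˢ right = no λ ()
right ≟ˢ cut   = no λ ()
right ≟ˢ left  = no λ ()
right ≟ˢ right = yes ≡.refl

opposite : Side → Side
opposite cut   = cut
opposite left  = right
opposite right = left

opposite≢cut : ∀ {t} → t ≢ cut → opposite t ≢ cut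
opposite≢cut {cut} t≢cut = t≢cut
opposite≢cut {left}  _ ()
opposite≢cut {right} _ ()

opposite≢ : ∀ {t} → t ≢ cut → opposite t ≢ t
opposite≢ {cut} t≢cut = t≢cut
opposite≢ {left}  _ ()
opposite≢ {right} _ ()

module _ (G : Hypergraph n) where
  open Hypergraph G

  -- What the estimates use of a cut: two nonempty sides with no edge across. One orientation of
  -- `no-crossing` is enough, since exchanging the two endpoints gives the other.
  record Separation (S : Subset n) : Set where
    field
      side        : Fin n → Side
      ∈⇒cut       : ∀ {i} → i ∈ S → side i ≡ cut
      cut⇒∈       : ∀ {i} → side i ≡ cut → i ∈ S
      no-crossing : ∀ {e i j} → e ∈ˡ edges → i ∈ e → j ∈ e → side i ≡ left → side j ≢ right
      nonempty    : ∀ t → t ≢ cut → ∃[ i ] side i ≡ t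

    same-side : ∀ {e i j} → e ∈ˡ edges → i ∈ e → j ∈ e → side i ≢ cut → side j ≢ cut → side i ≡ side j
    same-side {i = i} {j} e∈ i∈ j∈ i≢cut j≢cut with side i in eqi | side j in eqj
    ... | cut   | _     = contradiction ≡.refl i≢cut
    ... | left  | cut   = contradiction ≡.refl j≢cut
    ... | right | cut   = contradiction ≡.refl j≢cut
    ... | left  | left  = ≡.refl
    ... | right | right = ≡.refl
    ... | left  | right = contradiction eqj (no-crossing e∈ i∈ j∈ eqi)
    ... | right | left  = contradiction eqi (no-crossing e∈ j∈ i∈ eqj)

  connected⇒components≤1 : Connected G → ∀ {c} → HasComponents setSystem c → c ℕ.≤ 1
  connected⇒components≤1 conn {zero}        comps = z≤n
  connected⇒components≤1 conn {suc zero}    comps = s≤s z≤n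
  connected⇒components≤1 conn {suc (suc c)} comps
    with HasComponents.surjective comps zero | HasComponents.surjective comps (suc zero)
  ... | u , eq₀ | v , eq₁ with ≡.trans (≡.sym eq₀) (≡.trans
          (HasComponents.path⇒≡ comps u v (conn (proj₁ u) (proj₁ v))) eq₁)
  ...   | ()

  weakDelete-edge : ∀ {S i j} → Adjacent (weakDelete S setSystem) i j →
    ∃[ e ] e ∈ˡ edges × i ∈ e × j ∈ e × i ∉ S × j ∉ S
  weakDelete-edge {S} (_ , any) with find (Any.map⁻ any)
  ... | e , e∈ , i∈ , j∈ = e , e∈ , p─q⊆p e S i∈ , p─q⊆p e S j∈ , ∈─⇒∉ i∈ , ∈─⇒∉ j∈

  -- The vertex `i₀` needs a label, so the original system has at least one component and the
  -- deleted one at least two. The component labelled `zero` becomes the left side and all others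
  -- together the right side.
  weakCut⇒separation : Fin n → ∀ {S} → IsWeakCut G S → Separation S
  weakCut⇒separation i₀ {S} (zero , _ , comps , _) with HasComponents.component comps (i₀ , ∈⊤)
  ... | ()
  weakCut⇒separation i₀ {S} (suc c , suc zero , _ , _ , s≤s ())
  weakCut⇒separation i₀ {S} (suc c , suc (suc c′) , _ , comps′ , _) = record
    { side = λ i → side (i ∈? S)
    ; ∈⇒cut = λ {i} → ∈⇒cut (i ∈? S)
    ; cut⇒∈ = λ {i} → cut⇒∈ (i ∈? S)
    ; no-crossing = λ {e} {i} {j} → no-crossing (i ∈? S) (j ∈? S)
    ; nonempty = nonempty
    }
    where
    open HasComponents comps′
    label : ∀ {i} → i ∉ S → Fin (suc (suc c′))
    label {i} i∉S = component (i , x∈p∧x∉q⇒x∈p─q ∈⊤ i∉S)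
    ofLabel : Fin (suc (suc c′)) → Side
    ofLabel zero    = left
    ofLabel (suc _) = right
    ofLabel≢cut : ∀ l → ofLabel l ≢ cut
    ofLabel≢cut zero    ()
    ofLabel≢cut (suc _) ()
    side : ∀ {i} → Dec (i ∈ S) → Side
    side (yes _)   = cut
    side (no i∉S) = ofLabel (label i∉S)
    ∈⇒cut : ∀ {i} (d : Dec (i ∈ S)) → i ∈ S → side d ≡ cut
    ∈⇒cut (yes _)  _   = ≡.refl
    ∈⇒cut (no i∉S) i∈S = contradiction i∈S i∉S
    cut⇒∈ : ∀ {i} (d : Dec (i ∈ S)) → side d ≡ cut → i ∈ S
    cut⇒∈ (yes i∈S) _  = i∈S
    cut⇒∈ (no i∉S)  eq = contradiction eq (ofLabel≢cut (label i∉S))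
    -- A label formally depends on the membership proof; the empty path shows that its value does
    -- not.
    label-≡ : ∀ {i j} (u : i ∈ ⊤ ─ S) (v : j ∈ ⊤ ─ S) → i ≡ j → component (i , u) ≡ component (j , v)
    label-≡ u v ≡.refl = path⇒≡ (_ , u) (_ , v) ε
    no-crossing : ∀ {e i j} (d : Dec (i ∈ S)) (d′ : Dec (j ∈ S)) →
      e ∈ˡ edges → i ∈ e → j ∈ e → side d ≡ left → side d′ ≢ right
    no-crossing (no i∉S) (no j∉S) e∈ i∈e j∈e eq eq′ = clash (label i∉S) (label j∉S) same eq eq′
      where
      clash : ∀ l l′ → l ≡ l′ → ofLabel l ≡ left → ofLabel l′ ≢ right
      clash zero _ ≡.refl _ ()
      same : label i∉S ≡ label j∉S
      -- Adjacency demands distinct vertices, so a shared edge yields a path of length one only when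
      -- they differ.
      same with _ Fin.≟ _
      ... | yes i≡j = label-≡ _ _ i≡j
      ... | no i≢j = path⇒≡ (_ , x∈p∧x∉q⇒x∈p─q ∈⊤ i∉S) (_ , x∈p∧x∉q⇒x∈p─q ∈⊤ j∉S) ((i≢j , Any.map⁺ (lose e∈
        (x∈p∧x∉q⇒x∈p─q i∈e i∉S , x∈p∧x∉q⇒x∈p─q j∈e j∉S))) ◅ ε)
    representative : ∀ l → ∃[ i ] side (i ∈? S) ≡ ofLabel l
    representative l with surjective l
    ... | (i , i∈) , eq = i , of-dec (i ∈? S)
      where
      of-dec : (d : Dec (i ∈ S)) → side d ≡ ofLabel l
      of-dec (yes i∈S) = contradiction i∈S (∈─⇒∉ i∈)
      of-dec (no i∉S)  = ≡.cong ofLabel (≡.trans (label-≡ _ i∈ ≡.refl) eq)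
    nonempty : ∀ t → t ≢ cut → ∃[ i ] side (i ∈? S) ≡ t
    nonempty cut   t≢cut = contradiction ≡.refl t≢cut
    nonempty left  _     = representative zero
    nonempty right _     = representative (suc zero)

  -- Connectedness leaves at most one component before deletion, while two surviving vertices
  -- without a path between them carry different labels afterwards.
  disconnected⇒weakCut : Connected G → ∀ {S} → (∃[ c ] HasComponents setSystem c) →
    ∀ {i j} → i ∉ S → j ∉ S → ¬ Path (weakDelete S setSystem) i j → ¬ ¬ IsWeakCut G S
  disconnected⇒weakCut conn {S} (c , comps) i∉S j∉S no-path k =
    ¬¬-hasComponents (weakDelete S setSystem) λ (c′ , comps′) → k (c , c′ , comps , comps′ ,
      ℕ.≤-<-trans (connected⇒components≤1 conn comps)
        (2≤ (component comps′ (_ , x∈p∧x∉q⇒x∈p─q ∈⊤ i∉S)) (component comps′ (_ , x∈p∧x∉q⇒x∈p─q ∈⊤ j∉S))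
          (no-path ∘ ≡⇒path comps′ _ _)))
    where
    open HasComponents
    2≤ : ∀ {c} (a b : Fin c) → a ≢ b → 2 ℕ.≤ c
    2≤ {suc zero}    zero zero a≢b = contradiction ≡.refl a≢b
    2≤ {suc (suc c)} _    _    _   = s≤s (s≤s z≤n)

  module _ (conn : Connected G) {S : Subset n} (S-cut : IsWeakCut G S)
    (S-min : ∀ T → IsWeakCut G T → ∣ S ∣ ℕ.≤ ∣ T ∣) (sep : Separation S) where
    open Separation sep

    Meets : Fin n → Side → Subset n → Set
    Meets s t e = s ∈ e × ∃[ i ] i ∈ e × side i ≡ t

    meets? : ∀ s t e → Dec (Meets s t e)
    meets? s t e = (s ∈? e) ×-dec Fin.any? λ i → (i ∈? e) ×-dec (side i ≟ˢ t)

    -- After deleting all of `S` except `s`, a path can leave side `t` only through `s`, because no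
    -- edge joins the two sides. Entering `s` from `t` would take an edge that contains `s` and
    -- meets `t`.
    side-stays : ∀ {s t} → t ≢ cut → ¬ Any (Meets s t) edges →
      ∀ {i j} → side i ≡ t → Path (weakDelete (S ∖ s) setSystem) i j → side j ≡ t
    side-stays t≢cut avoids i∈t ε = i∈t
    side-stays {s} {t} t≢cut avoids {i} i∈t (_◅_ {j = j} i~j path) with weakDelete-edge i~j
    ... | e , e∈ , i∈e , j∈e , _ , j∉S-s = side-stays t≢cut avoids j∈t path
      where
      j≢s : j ≢ s
      j≢s j≡s = avoids (lose e∈ (≡.subst (_∈ e) j≡s j∈e , i , i∈e , i∈t))
      j∉cut : side j ≢ cut
      j∉cut j∈cut = j∉S-s (x∈p∧x≢y⇒x∈p-y (cut⇒∈ j∈cut) j≢s)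
      j∈t : side j ≡ t
      j∈t = ≡.trans (≡.sym (same-side e∈ i∈e j∈e (t≢cut ∘ ≡.trans (≡.sym i∈t)) j∉cut)) i∈t

    -- Otherwise S without s would still separate side t from s.
    minimal-cut-meets : ∀ {s} → s ∈ S → ∀ t → t ≢ cut → Any (Meets s t) edges
    minimal-cut-meets {s} s∈S t t≢cut = decidable-stable (Any.any? (meets? s t) edges) λ avoids →
      let x , x∈t = nonempty t t≢cut
          c , _ , comps , _ = S-cut
      in disconnected⇒weakCut conn {S ∖ s} (c , comps)
        (λ x∈S-s → t≢cut (≡.trans (≡.sym x∈t) (∈⇒cut (p─q⊆p S _ x∈S-s))))
        (λ s∈S-s → ∈─⇒∉ s∈S-s (x∈⁅x⁆ s))
        (λ path → t≢cut (≡.trans (≡.sym (side-stays t≢cut avoids x∈t path)) (∈⇒cut s∈S)))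
        λ T-cut → ℕ.<⇒≱ (x∈p⇒∣p-x∣<∣p∣ s∈S) (S-min (S ∖ s) T-cut)

    -- The strict inequality is witnessed by an edge through `s` that meets the side opposite to
    -- `i`: it counts towards the degree of `s`, but containing `i` as well it would cross.
    codegree<degree : ∀ {i s} → side i ≢ cut → s ∈ S →
      length (filter (λ e → (i ∈? e) ×-dec (s ∈? e)) edges) ℕ.< degree G s
    codegree<degree {i} {s} i∉cut s∈S
      with find (minimal-cut-meets s∈S (opposite (side i)) (opposite≢cut i∉cut))
    ... | e , e∈ , s∈e , j , j∈e , j-side =
      length-filter-< (λ e → (i ∈? e) ×-dec (s ∈? e)) (s ∈?_) proj₂ e∈ s∈e λ (i∈e , _) →
        opposite≢ i∉cut (≡.trans (≡.sym j-side) (≡.sym (same-side e∈ i∈e j∈e i∉cut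
          (opposite≢cut i∉cut ∘ ≡.trans (≡.sym j-side)))))

module OverReals {c ℓ₁ ℓ₂ : Level} (ℝ : Reals c ℓ₁ ℓ₂) where

  open Reals ℝ
  open CommutativeRing commutativeRing using (ring)
  open HeytingCommutativeRingProperties heytingCommutativeRing
    using (#-congʳ; x-0≈x; x#0y#0→xy#0; invertibleˡ⇒#)
  open RawSemiringDefinitions rawSemiring using (_^_; product)
  open RingProperties ring using (-0#≈0#; -‿distribˡ-*; -‿distribʳ-*; -‿involutive; -‿+-comm)
  open SemiringSum semiring 
    using (sum; sum-cong-≋; sum-remove; sum-replicate-zero; *-distribˡ-sum; *-distribʳ-sum; ∑-comm; ∑-distrib-+)
  open SetoidReasoning setoid

  private
    module < = IsStrictPartialOrder isStrictPartialOrder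

  -- Ordered-field arithmetic

  module IntegerCoefficients where
    open SemiringMult semiring using (×-homo-+; ×1-homo-*; 1+×) renaming (_×_ to _·_)

    -- Integer coefficients give the ring solver a decidable coefficient equality, which `Carrier`
    -- lacks. With the optimised multiples, `con (+ 1)` and `con -[1+ 0 ]` reduce to `1#` and
    -- `- 1#`, so solver equations match the goals as written.
    ⟦_⟧ : ℤ → Carrier
    ⟦ + k ⟧      = k · 1#
    ⟦ -[1+ k ] ⟧ = - (suc k · 1#)

    neg-homo : ∀ i → ⟦ ℤ.- i ⟧ ≈ - ⟦ i ⟧
    neg-homo (+ zero)  = sym -0#≈0#
    neg-homo (+ suc k) = refl
    neg-homo -[1+ k ]  = sym (-‿involutive _)

    1+-cancel : ∀ x y → x - y ≈ (1# + x) - (1# + y)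
    1+-cancel x y = sym (begin
      (1# + x) - (1# + y)        ≈⟨ +-congˡ (-‿+-comm 1# y) ⟨
      (1# + x) + (- 1# + - y)    ≈⟨ +-congʳ (+-comm 1# x) ⟩
      (x + 1#) + (- 1# + - y)    ≈⟨ +-assoc x 1# _ ⟩
      x + (1# + (- 1# + - y))    ≈⟨ +-congˡ (+-assoc 1# (- 1#) (- y)) ⟨
      x + ((1# + - 1#) + - y)    ≈⟨ +-congˡ (+-congʳ (-‿inverseʳ 1#)) ⟩
      x + (0# + - y)             ≈⟨ +-congˡ (+-identityˡ (- y)) ⟩
      x - y                      ∎)

    ⊖-homo : ∀ j k → ⟦ j ℤ.⊖ k ⟧ ≈ j · 1# - k · 1#
    ⊖-homo j zero = begin
      ⟦ j ℤ.⊖ 0 ⟧     ≡⟨ ≡.cong ⟦_⟧ (ℤ.⊖-≥ {j} z≤n) ⟩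
      j · 1#          ≈⟨ +-identityʳ _ ⟨
      j · 1# + 0#     ≈⟨ +-congˡ -0#≈0# ⟨
      j · 1# - 0#     ∎
    ⊖-homo zero (suc k) = sym (+-identityˡ _)
    ⊖-homo (suc j) (suc k) = begin
      ⟦ suc j ℤ.⊖ suc k ⟧              ≡⟨ ≡.cong ⟦_⟧ (ℤ.[1+m]⊖[1+n]≡m⊖n j k) ⟩
      ⟦ j ℤ.⊖ k ⟧                      ≈⟨ ⊖-homo j k ⟩
      j · 1# - k · 1#                  ≈⟨ 1+-cancel _ _ ⟩
      (1# + j · 1#) - (1# + k · 1#)    ≈⟨ +-cong (1+× j 1#) (-‿cong (1+× k 1#)) ⟨
      suc j · 1# - suc k · 1#          ∎

    +-homo : ∀ i j → ⟦ i ℤ.+ j ⟧ ≈ ⟦ i ⟧ + ⟦ j ⟧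
    +-homo (+ j)    (+ k)    = ×-homo-+ 1# j k
    +-homo (+ j)    -[1+ k ] = ⊖-homo j (suc k)
    +-homo -[1+ j ] (+ k)    = trans (⊖-homo k (suc j)) (+-comm _ _)
    +-homo -[1+ j ] -[1+ k ] = begin
      - (suc (suc (j ℕ.+ k)) · 1#)       ≡⟨ ≡.cong (λ l → - (suc l · 1#)) (ℕ.+-suc j k) ⟨
      - ((suc j ℕ.+ suc k) · 1#)         ≈⟨ -‿cong (×-homo-+ 1# (suc j) (suc k)) ⟩
      - (suc j · 1# + suc k · 1#)        ≈⟨ -‿+-comm _ _ ⟨
      - (suc j · 1#) + - (suc k · 1#)    ∎

    -◃-homo : ∀ k → ⟦ Sign.- ℤ.◃ k ⟧ ≈ - (k · 1#)
    -◃-homo zero    = sym -0#≈0#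
    -◃-homo (suc k) = refl

    *-homo : ∀ i j → ⟦ i ℤ.* j ⟧ ≈ ⟦ i ⟧ * ⟦ j ⟧
    *-homo (+ j) (+ k) = begin
      ⟦ Sign.+ ℤ.◃ (j ℕ.* k) ⟧  ≡⟨ ≡.cong ⟦_⟧ (ℤ.+◃n≡+n (j ℕ.* k)) ⟩
      (j ℕ.* k) · 1#            ≈⟨ ×1-homo-* j k ⟩
      j · 1# * k · 1#           ∎
    *-homo (+ j) -[1+ k ] = begin
      ⟦ Sign.- ℤ.◃ (j ℕ.* suc k) ⟧  ≈⟨ -◃-homo (j ℕ.* suc k) ⟩
      - ((j ℕ.* suc k) · 1#)        ≈⟨ -‿cong (×1-homo-* j (suc k)) ⟩
      - (j · 1# * suc k · 1#)       ≈⟨ -‿distribʳ-* _ _ ⟩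
      j · 1# * - (suc k · 1#)       ∎
    *-homo -[1+ j ] (+ k) = begin
      ⟦ Sign.- ℤ.◃ (suc j ℕ.* k) ⟧  ≈⟨ -◃-homo (suc j ℕ.* k) ⟩
      - ((suc j ℕ.* k) · 1#)        ≈⟨ -‿cong (×1-homo-* (suc j) k) ⟩
      - (suc j · 1# * k · 1#)       ≈⟨ -‿distribˡ-* _ _ ⟩
      - (suc j · 1#) * k · 1#       ∎
    *-homo -[1+ j ] -[1+ k ] = begin
      (suc j ℕ.* suc k) · 1#              ≈⟨ ×1-homo-* (suc j) (suc k) ⟩
      suc j · 1# * suc k · 1#             ≈⟨ -‿involutive _ ⟨
      - - (suc j · 1# * suc k · 1#)       ≈⟨ -‿cong (-‿distribʳ-* _ _) ⟩
      - (suc j · 1# * - (suc k · 1#))     ≈⟨ -‿distribˡ-* _ _ ⟩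
      - (suc j · 1#) * - (suc k · 1#)     ∎

    homomorphism : ℤ.+-*-rawRing -Raw-AlmostCommutative⟶ fromCommutativeRing commutativeRing
    homomorphism = record
      { ⟦_⟧ = ⟦_⟧ ; +-homo = +-homo ; *-homo = *-homo ; -‿homo = neg-homo ; 0-homo = refl ; 1-homo = refl }

    _≟′_ : ∀ i j → Maybe (⟦ i ⟧ ≈ ⟦ j ⟧)
    i ≟′ j with i ℤ.≟ j
    ... | yes ≡.refl = just refl
    ... | no  _      = nothing

  open RingSolver ℤ.+-*-rawRing (fromCommutativeRing commutativeRing)
    IntegerCoefficients.homomorphism IntegerCoefficients._≟′_
    using (solve; _:=_; _:+_; _:*_; :-_; _:-_; con)

  -- Tightness turns the failure of `x # 0#` into `x ≈ 0#`, so a negated goal may be split on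
  -- whether `x` vanishes. Since `_≤_` is a negation, this applies to every inequality of that form.
  by-zero-cases : ∀ {a} {A : Set a} x → (x ≈ 0# → ¬ A) → (x # 0# → ¬ A) → ¬ A
  by-zero-cases x x≈0⇒¬a x#0⇒¬a a =
    x≈0⇒¬a (proj₁ (tight x 0#) λ x#0 → x#0⇒¬a x#0 a) a

  <-asym : ∀ {x y} → x < y → ¬ (y < x)
  <-asym = <.asym

  <-irrefl : ∀ {x} → ¬ (x < x)
  <-irrefl = <.irrefl refl

  -- The substitute for a decidable order: it makes the negatively defined `_≤_` transitive and lets
  -- it compose with `_<_`.
  <-cotrans : ∀ {x y} z → x < y → x < z ⊎ z < y
  <-cotrans z x<y with #-cotrans (<⇒# x<y) z
  ... | inj₁ x#z with #⇒<⊎> x#z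
  ...   | inj₁ x<z = inj₁ x<z
  ...   | inj₂ z<x = inj₂ (<-trans z<x x<y)
  <-cotrans z x<y | inj₂ z#y with #⇒<⊎> z#y
  ...   | inj₁ z<y = inj₂ z<y
  ...   | inj₂ y<z = inj₁ (<-trans x<y y<z)

  <⇒≤ : ∀ {x y} → x < y → x ≤ y
  <⇒≤ = <-asym

  ≤-reflexive : ∀ {x y} → x ≈ y → x ≤ y
  ≤-reflexive x≈y y<x = <.irrefl (sym x≈y) y<x

  ≤-refl : ∀ {x} → x ≤ x
  ≤-refl = ≤-reflexive refl

  ≤-trans : ∀ {x y z} → x ≤ y → y ≤ z → x ≤ z
  ≤-trans {y = y} x≤y y≤z z<x with <-cotrans y z<x
  ... | inj₁ z<y = y≤z z<y
  ... | inj₂ y<x = x≤y y<x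

  <-≤-trans : ∀ {x y z} → x < y → y ≤ z → x < z
  <-≤-trans {z = z} x<y y≤z with <-cotrans z x<y
  ... | inj₁ x<z = x<z
  ... | inj₂ z<y = contradiction z<y y≤z

  ≤-<-trans : ∀ {x y z} → x ≤ y → y < z → x < z
  ≤-<-trans {x} x≤y y<z with <-cotrans x y<z
  ... | inj₁ y<x = contradiction y<x x≤y
  ... | inj₂ x<z = x<z

  ≤-antisym : ∀ {x y} → x ≤ y → y ≤ x → x ≈ y
  ≤-antisym {x} {y} x≤y y≤x = proj₁ (tight x y) λ x#y → case (#⇒<⊎> x#y)
    where
    case : x < y ⊎ y < x → ⊥
    case (inj₁ x<y) = y≤x x<y
    case (inj₂ y<x) = x≤y y<x

  ≤-respʳ : ∀ {x y z} → y ≈ z → x ≤ y → x ≤ z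
  ≤-respʳ y≈z x≤y = ≤-trans x≤y (≤-reflexive y≈z)

  ≤-respˡ : ∀ {x y z} → x ≈ y → x ≤ z → y ≤ z
  ≤-respˡ x≈y x≤z = ≤-trans (≤-reflexive (sym x≈y)) x≤z

  +-monoˡ-≤ : ∀ z {x y} → x ≤ y → x + z ≤ y + z
  +-monoˡ-≤ z {x} {y} x≤y y+z<x+z =
    x≤y (<-respˡ (cancel y) (<-respʳ (cancel x) (+-monoˡ-< (- z) y+z<x+z)))
    where
    cancel : ∀ u → u + z - z ≈ u
    cancel u = solve 2 (λ u z → u :+ z :- z := u) refl u z

  +-mono-≤ : ∀ {x y u v} → x ≤ y → u ≤ v → x + u ≤ y + v
  +-mono-≤ {x} {y} {u} {v} x≤y u≤v = ≤-trans (+-monoˡ-≤ u x≤y)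
    (≤-respˡ (+-comm u y) (≤-respʳ (+-comm v y) (+-monoˡ-≤ y u≤v)))

  neg-pos : ∀ {x} → x < 0# → 0# < - x
  neg-pos {x} x<0 = <-respˡ (-‿inverseʳ x) (<-respʳ (+-identityˡ (- x)) (+-monoˡ-< (- x) x<0))

  x≤y⇒0≤y-x : ∀ {x y} → x ≤ y → 0# ≤ y - x
  x≤y⇒0≤y-x {x} x≤y = ≤-respˡ (-‿inverseʳ x) (+-monoˡ-≤ (- x) x≤y)

  0≤y-x⇒x≤y : ∀ {x y} → 0# ≤ y - x → x ≤ y
  0≤y-x⇒x≤y {x} {y} 0≤y-x = ≤-respˡ (+-identityˡ x)
    (≤-respʳ (solve 2 (λ x y → y :- x :+ x := y) refl x y) (+-monoˡ-≤ x 0≤y-x))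

  #0⇒0<x² : ∀ {x} → x # 0# → 0# < x * x
  #0⇒0<x² {x} x#0 with #⇒<⊎> x#0
  ... | inj₁ x<0 = <-respʳ (solve 1 (λ x → (:- x) :* (:- x) := x :* x) refl x)
                     (*-pos (neg-pos x<0) (neg-pos x<0))
  ... | inj₂ 0<x = *-pos 0<x 0<x

  0≤x² : ∀ x → 0# ≤ x * x
  0≤x² x = by-zero-cases x
    (λ x≈0 → ≤-reflexive (sym (trans (*-congʳ x≈0) (zeroˡ x))))
    (λ x#0 → <⇒≤ (#0⇒0<x² x#0))

  x²≈0⇒x≈0 : ∀ {x} → x * x ≈ 0# → x ≈ 0#
  x²≈0⇒x≈0 {x} x²≈0 = proj₁ (tight x 0#) λ x#0 → <-irrefl (<-respʳ x²≈0 (#0⇒0<x² x#0))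

  *-nonneg : ∀ {x y} → 0# ≤ x → 0# ≤ y → 0# ≤ x * y
  *-nonneg {x} {y} 0≤x 0≤y = by-zero-cases x
    (λ x≈0 → ≤-reflexive (sym (trans (*-congʳ x≈0) (zeroˡ y))))
    λ x#0 → by-zero-cases y
    (λ y≈0 → ≤-reflexive (sym (trans (*-congˡ y≈0) (zeroʳ x))))
    λ y#0 → <⇒≤ (*-pos (positive 0≤x x#0) (positive 0≤y y#0))
    where
    positive : ∀ {z} → 0# ≤ z → z # 0# → 0# < z
    positive 0≤z z#0 with #⇒<⊎> z#0
    ... | inj₁ z<0 = contradiction z<0 0≤z
    ... | inj₂ 0<z = 0<z

  *-monoʳ-≤ : ∀ {x y z} → 0# ≤ z → x ≤ y → z * x ≤ z * y
  *-monoʳ-≤ {x} {y} {z} 0≤z x≤y = 0≤y-x⇒x≤y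
    (≤-respʳ (solve 3 (λ x y z → z :* (y :- x) := z :* y :- z :* x) refl x y z)
      (*-nonneg 0≤z (x≤y⇒0≤y-x x≤y)))

  *-cancel-≤ : ∀ {x y z} → 0# < z → z * x ≤ z * y → x ≤ y
  *-cancel-≤ {x} {y} {z} 0<z zx≤zy y<x = zx≤zy
    (<-respˡ (+-identityˡ _) (<-respʳ (solve 3 (λ x y z → z :* (x :- y) :+ z :* y := z :* x) refl x y z)
      (+-monoˡ-< (z * y) (*-pos 0<z 0<x-y))))
    where
    0<x-y : 0# < x - y
    0<x-y = <-respˡ (-‿inverseʳ y) (+-monoˡ-< (- y) y<x)

  #0-cancel : ∀ {x y} → x # 0# → x * y ≈ 0# → y ≈ 0#
  #0-cancel {x} {y} x#0 xy≈0 with #⇒invertible x#0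
  ... | x⁻¹ , x⁻¹x≈1 , _ = begin
    y                    ≈⟨ *-identityˡ y ⟨
    1# * y               ≈⟨ *-congʳ x⁻¹x≈1 ⟨
    x⁻¹ * (x - 0#) * y   ≈⟨ solve 3 (λ u x y → u :* (x :- con (+ 0)) :* y := u :* (x :* y)) refl x⁻¹ x y ⟩
    x⁻¹ * (x * y)        ≈⟨ *-congˡ xy≈0 ⟩
    x⁻¹ * 0#             ≈⟨ zeroʳ x⁻¹ ⟩
    0#                   ∎

  <⇒-#0 : ∀ {x y} → x < y → y - x # 0#
  <⇒-#0 {x} x<y = #-sym (<⇒# (<-respˡ (-‿inverseʳ x) (+-monoˡ-< (- x) x<y)))

  x-y≈0⇒x≈y : ∀ {x y} → x - y ≈ 0# → x ≈ y
  x-y≈0⇒x≈y {x} {y} x-y≈0 = begin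
    x          ≈⟨ solve 2 (λ x y → x := (x :- y) :+ y) refl x y ⟩
    x - y + y  ≈⟨ +-congʳ x-y≈0 ⟩
    0# + y     ≈⟨ +-identityˡ y ⟩
    y          ∎

  x≈y⇒x-y≈0 : ∀ {x y} → x ≈ y → x - y ≈ 0#
  x≈y⇒x-y≈0 {y = y} x≈y = trans (+-congʳ x≈y) (-‿inverseʳ y)

  fromℕ-mono-≤ : ∀ {j k} → j ℕ.≤ k → fromℕ j ≤ fromℕ k
  fromℕ-mono-≤ {k = zero} z≤n = ≤-refl
  fromℕ-mono-≤ {k = suc k} z≤n = <⇒≤ (0<fromℕ k)
  fromℕ-mono-≤ (s≤s j≤k) = +-mono-≤ ≤-refl (fromℕ-mono-≤ j≤k)

  0≤fromℕ : ∀ k → 0# ≤ fromℕ k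
  0≤fromℕ k = fromℕ-mono-≤ {0} {k} z≤n

  fromℕ-<-suc : ∀ k → fromℕ k < fromℕ (suc k)
  fromℕ-<-suc k = <-respˡ (+-identityˡ _) (+-monoˡ-< (fromℕ k) 0<1)

  fromℕ-mono-< : ∀ {j k} → j ℕ.< k → fromℕ j < fromℕ k
  fromℕ-mono-< {j} j<k = <-≤-trans (fromℕ-<-suc j) (fromℕ-mono-≤ j<k)

  fromℕ*1/ℕ : ∀ k → fromℕ (suc k) * 1/ℕ (suc k) ≈ 1#
  fromℕ*1/ℕ k with #⇒invertible {fromℕ (suc k)} {0#} (#-sym (<⇒# (0<fromℕ k)))
  ... | u , _ , ku≈1 = trans (*-congʳ (sym (x-0≈x _))) ku≈1

  0<1/ℕ : ∀ k → 0# < 1/ℕ (suc k)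
  0<1/ℕ k with #⇒<⊎> (invertibleˡ⇒# (fromℕ (suc k) , trans (*-congˡ (x-0≈x _)) (fromℕ*1/ℕ k)))
  ... | inj₂ 0<u = 0<u
  ... | inj₁ u<0 = contradiction 0<-1 λ 0<-1 → <-asym 0<1
    (<-respˡ (+-identityˡ 1#) (<-respʳ (-‿inverseˡ 1#) (+-monoˡ-< 1# 0<-1)))
    where
    0<-1 : 0# < - 1#
    0<-1 = <-respʳ (trans (sym (-‿distribʳ-* _ _)) (-‿cong (fromℕ*1/ℕ k)))
      (*-pos (0<fromℕ k) (neg-pos u<0))

  fromℕ*1/ℕ≤1 : ∀ {j k} → j ℕ.≤ suc k → fromℕ j * 1/ℕ (suc k) ≤ 1#
  fromℕ*1/ℕ≤1 {j} {k} j≤1+k = ≤-respˡ (*-comm _ _) (≤-respʳ (trans (*-comm _ _) (fromℕ*1/ℕ k))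
    (*-monoʳ-≤ (<⇒≤ (0<1/ℕ k)) (fromℕ-mono-≤ j≤1+k)))

  sum-nonneg : ∀ {n} (f : Fin n → Carrier) → (∀ i → 0# ≤ f i) → 0# ≤ sum f
  sum-nonneg {zero}  f 0≤f = ≤-refl
  sum-nonneg {suc n} f 0≤f = ≤-respˡ (+-identityˡ 0#)
    (+-mono-≤ (0≤f zero) (sum-nonneg (f ∘ suc) (0≤f ∘ suc)))

  sum-mono-≤ : ∀ {n} (f g : Fin n → Carrier) → (∀ i → f i ≤ g i) → sum f ≤ sum g
  sum-mono-≤ {zero}  f g f≤g = ≤-refl
  sum-mono-≤ {suc n} f g f≤g = +-mono-≤ (f≤g zero) (sum-mono-≤ (f ∘ suc) (g ∘ suc) (f≤g ∘ suc))

  term≤sum : ∀ {n} (f : Fin n → Carrier) → (∀ i → 0# ≤ f i) → ∀ i → f i ≤ sum f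
  term≤sum {suc n} f 0≤f zero = ≤-respˡ (+-identityʳ _)
    (+-mono-≤ ≤-refl (sum-nonneg (f ∘ suc) (0≤f ∘ suc)))
  term≤sum {suc n} f 0≤f (suc i) = ≤-respˡ (+-identityˡ _)
    (+-mono-≤ (0≤f zero) (term≤sum (f ∘ suc) (0≤f ∘ suc) i))

  sum≈0⇒≈0 : ∀ {n} (f : Fin n → Carrier) → (∀ i → 0# ≤ f i) → sum f ≈ 0# → ∀ i → f i ≈ 0#
  sum≈0⇒≈0 f 0≤f ∑f≈0 i = ≤-antisym (≤-respʳ ∑f≈0 (term≤sum f 0≤f i)) (0≤f i)

  sum-zero : ∀ {n} (f : Fin n → Carrier) → (∀ i → f i ≈ 0#) → sum f ≈ 0#
  sum-zero {n} f f≈0 = trans (sum-cong-≋ f≈0) (sum-replicate-zero n)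

  sum-single : ∀ {n} (f : Fin n → Carrier) i → (∀ j → j ≢ i → f j ≈ 0#) → sum f ≈ f i
  sum-single {suc n} f i f≈0 = begin
    sum f                        ≈⟨ sum-remove {i = i} f ⟩
    f i + sum (removeAt f i)     ≈⟨ +-congˡ (sum-zero _ λ j → f≈0 (punchIn i j) (Fin.punchInᵢ≢i i j)) ⟩
    f i + 0#                     ≈⟨ +-identityʳ _ ⟩
    f i                          ∎

  -- Determinants

  sum-linear : ∀ a (f g : Fin n → Carrier) → sum (λ i → a * f i + g i) ≈ a * sum f + sum g
  sum-linear a f g = trans (∑-distrib-+ (λ i → a * f i) g) (+-congʳ (sym (*-distribˡ-sum a f)))

  sign : Fin n → Carrier
  sign j = (- 1#) ^ toℕ j

  minor : Matrix ℝ (suc n) → Fin (suc n) → Matrix ℝ n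
  minor M j r c = M (suc r) (punchIn j c)

  det-cong : {A B : Matrix ℝ n} → (∀ r c → A r c ≈ B r c) → det ℝ A ≈ det ℝ B
  det-cong {zero}  A≈B = refl
  det-cong {suc n} A≈B = sum-cong-≋ {suc n} λ j →
    *-cong (*-congˡ {sign j} (A≈B zero j)) (det-cong λ r c → A≈B (suc r) (punchIn j c))

  -- In the expansion along the first row, the term for column `k` has the linear entry as its
  -- factor and a minor without that column; in every other term the minor carries the linearity.
  -- Three matrices agreeing off column `k`, rather than updates of one matrix, let the induction
  -- pass to minors directly.
  det-linear : (k : Fin n) (a : Carrier) {A B C : Matrix ℝ n} →
    (∀ r → A r k ≈ a * B r k + C r k) →
    (∀ r c → c ≢ k → A r c ≈ B r c) → (∀ r c → c ≢ k → A r c ≈ C r c) →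
    det ℝ A ≈ a * det ℝ B + det ℝ C
  det-linear {suc n} k a {A} {B} {C} A≈aB+C A≈B A≈C = trans (sum-cong-≋ {suc n} term)
    (sum-linear {suc n} a (λ j → sign j * B zero j * det ℝ (minor B j))
      (λ j → sign j * C zero j * det ℝ (minor C j)))
    where
    term : ∀ j → sign j * A zero j * det ℝ (minor A j) ≈
      a * (sign j * B zero j * det ℝ (minor B j)) + sign j * C zero j * det ℝ (minor C j)
    term j with j Fin.≟ k
    ... | yes ≡.refl = begin
      sign j * A zero j * det ℝ (minor A j)
        ≈⟨ *-congʳ (*-congˡ (A≈aB+C zero)) ⟩
      sign j * (a * B zero j + C zero j) * det ℝ (minor A j)
        ≈⟨ solve 5 (λ s a b c d → s :* (a :* b :+ c) :* d := a :* (s :* b :* d) :+ s :* c :* d)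
             refl (sign j) a (B zero j) (C zero j) (det ℝ (minor A j)) ⟩
      a * (sign j * B zero j * det ℝ (minor A j)) + sign j * C zero j * det ℝ (minor A j)
        ≈⟨ +-cong (*-congˡ (*-congˡ (det-cong λ r c → A≈B (suc r) _ (Fin.punchInᵢ≢i j c))))
                  (*-congˡ (det-cong λ r c → A≈C (suc r) _ (Fin.punchInᵢ≢i j c))) ⟩
      a * (sign j * B zero j * det ℝ (minor B j)) + sign j * C zero j * det ℝ (minor C j) ∎
    ... | no j≢k = begin
      sign j * A zero j * det ℝ (minor A j)
        ≈⟨ *-congˡ (det-linear k′ a
             (λ r → ≡.subst (λ l → A (suc r) l ≈ a * B (suc r) l + C (suc r) l) (≡.sym k≡) (A≈aB+C (suc r)))
             (λ r c c≢k′ → A≈B (suc r) _ (c≢k′ ∘ other c)) (λ r c c≢k′ → A≈C (suc r) _ (c≢k′ ∘ other c))) ⟩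
      sign j * A zero j * (a * det ℝ (minor B j) + det ℝ (minor C j))
        ≈⟨ solve 5 (λ s x a b c → s :* x :* (a :* b :+ c) := a :* (s :* x :* b) :+ s :* x :* c)
             refl (sign j) (A zero j) a (det ℝ (minor B j)) (det ℝ (minor C j)) ⟩
      a * (sign j * A zero j * det ℝ (minor B j)) + sign j * A zero j * det ℝ (minor C j)
        ≈⟨ +-cong (*-congˡ (*-congʳ (*-congˡ (A≈B zero j j≢k)))) (*-congʳ (*-congˡ (A≈C zero j j≢k))) ⟩
      a * (sign j * B zero j * det ℝ (minor B j)) + sign j * C zero j * det ℝ (minor C j) ∎
      where
      k′ = punchOut j≢k
      k≡ : punchIn j k′ ≡ k
      k≡ = Fin.punchIn-punchOut j≢k
      other : ∀ c → punchIn j c ≡ k → c ≡ k′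
      other c eq = Fin.punchIn-injective j c k′ (≡.trans eq (≡.sym k≡))

  swap : Fin n → Fin (suc n) → Fin (suc n)
  swap zero    zero          = suc zero
  swap zero    (suc zero)    = zero
  swap zero    (suc (suc c)) = suc (suc c)
  swap (suc i) zero          = zero
  swap (suc i) (suc c)       = suc (swap i c)

  swap-inject₁ : (i : Fin n) → swap i (inject₁ i) ≡ suc i
  swap-inject₁ zero    = ≡.refl
  swap-inject₁ (suc i) = ≡.cong suc (swap-inject₁ i)

  swap-suc : (i : Fin n) → swap i (suc i) ≡ inject₁ i
  swap-suc zero    = ≡.refl
  swap-suc (suc i) = ≡.cong suc (swap-suc i)

  swap-fixed : (i : Fin n) (c : Fin (suc n)) → c ≢ inject₁ i → c ≢ suc i → swap i c ≡ c
  swap-fixed zero    zero          c≢i c≢1+i = contradiction ≡.refl c≢i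
  swap-fixed zero    (suc zero)    c≢i c≢1+i = contradiction ≡.refl c≢1+i
  swap-fixed zero    (suc (suc c)) c≢i c≢1+i = ≡.refl
  swap-fixed (suc i) zero          c≢i c≢1+i = ≡.refl
  swap-fixed (suc i) (suc c)       c≢i c≢1+i =
    ≡.cong suc (swap-fixed i c (c≢i ∘ ≡.cong suc) (c≢1+i ∘ ≡.cong suc))

  sum-swap : (i : Fin n) (f : Fin (suc n) → Carrier) → sum (f ∘ swap i) ≈ sum f
  sum-swap zero f = solve 3 (λ x y z → x :+ (y :+ z) := y :+ (x :+ z)) refl _ _ _
  sum-swap (suc i) f = +-congˡ (sum-swap i (f ∘ suc))

  -- How an adjacent transposition meets the removal of column `j`. If `j` is one of the two
  -- columns, the removed position moves by one and its sign flips; if not, `j` stays and the minor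
  -- undergoes an adjacent transposition. Either way each term of the expansion changes sign once.
  swap-punchIn : (i : Fin (suc m)) (j : Fin (suc (suc m))) →
    (sign j ≈ - sign (swap i j) × (∀ c → swap i (punchIn j c) ≡ punchIn (swap i j) c)) ⊎
    (swap i j ≡ j × ∃[ i′ ] ∀ c → swap i (punchIn j c) ≡ punchIn j (swap i′ c))
  swap-punchIn zero zero = inj₁
    (solve 0 (con (+ 1) := :- (con -[1+ 0 ] :* con (+ 1))) refl ,
     λ { zero → ≡.refl ; (suc c) → ≡.refl })
  swap-punchIn zero (suc zero) = inj₁
    (solve 0 (con -[1+ 0 ] :* con (+ 1) := :- con (+ 1)) refl ,
     λ { zero → ≡.refl ; (suc c) → ≡.refl })
  swap-punchIn {suc m} zero (suc (suc j)) = inj₂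
    (≡.refl , zero , λ { zero → ≡.refl ; (suc zero) → ≡.refl ; (suc (suc c)) → ≡.refl })
  swap-punchIn {suc m} (suc i) zero = inj₂ (≡.refl , i , λ c → ≡.refl)
  swap-punchIn {suc m} (suc i) (suc j) with swap-punchIn i j
  ... | inj₁ (flipped , eq) = inj₁
    (trans (*-congˡ flipped) (sym (-‿distribʳ-* _ _)) ,
     λ { zero → ≡.refl ; (suc c) → ≡.cong suc (eq c) })
  ... | inj₂ (fixed , i′ , eq) = inj₂
    (≡.cong suc fixed , suc i′ , λ { zero → ≡.refl ; (suc c) → ≡.cong suc (eq c) })

  det-swap : (i : Fin n) (M : Matrix ℝ (suc n)) → det ℝ (λ r c → M r (swap i c)) ≈ - det ℝ M
  det-swap {suc n} i M = begin
    sum (λ j → sign j * M zero (swap i j) * det ℝ (λ r c → M (suc r) (swap i (punchIn j c))))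
      ≈⟨ sum-cong-≋ term ⟩
    sum (λ j → - 1# * T (swap i j))   ≈⟨ *-distribˡ-sum (- 1#) (T ∘ swap i) ⟨
    - 1# * sum (T ∘ swap i)           ≈⟨ *-congˡ (sum-swap i T) ⟩
    - 1# * sum T                      ≈⟨ solve 1 (λ x → con -[1+ 0 ] :* x := :- x) refl _ ⟩
    - sum T                           ∎
    where
    T : Fin (suc (suc n)) → Carrier
    T j = sign j * M zero j * det ℝ (minor M j)
    term : ∀ j → sign j * M zero (swap i j) * det ℝ (λ r c → M (suc r) (swap i (punchIn j c))) ≈
      - 1# * T (swap i j)
    term j with swap-punchIn i j
    ... | inj₁ (flipped , eq) = trans
      (*-cong (*-congʳ flipped) (det-cong λ r c → reflexive (≡.cong (M (suc r)) (eq c))))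
      (solve 3 (λ s x d → (:- s) :* x :* d := con -[1+ 0 ] :* (s :* x :* d)) refl _ _ _)
    ... | inj₂ (fixed , i′ , eq) = begin
      sign j * M zero (swap i j) * det ℝ (λ r c → M (suc r) (swap i (punchIn j c)))
        ≈⟨ *-congˡ (det-cong λ r c → reflexive (≡.cong (M (suc r)) (eq c))) ⟩
      sign j * M zero (swap i j) * det ℝ (λ r c → minor M j r (swap i′ c))
        ≈⟨ *-cong (reflexive (≡.cong (λ l → sign j * M zero l) fixed)) (det-swap i′ (minor M j)) ⟩
      sign j * M zero j * - det ℝ (minor M j)
        ≈⟨ solve 3 (λ s x d → s :* x :* (:- d) := con -[1+ 0 ] :* (s :* x :* d)) refl _ _ _ ⟩
      - 1# * T j
        ≡⟨ ≡.cong (λ l → - 1# * T l) fixed ⟨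
      - 1# * T (swap i j) ∎

  x≈-x⇒x≈0 : ∀ {x} → x ≈ - x → x ≈ 0#
  x≈-x⇒x≈0 {x} x≈-x = #0-cancel (#-sym (<⇒# (0<fromℕ 1))) (begin
    fromℕ 2 * x  ≈⟨ solve 1 (λ x → (con (+ 1) :+ (con (+ 1) :+ con (+ 0))) :* x := x :+ x) refl x ⟩
    x + x        ≈⟨ +-congˡ x≈-x ⟩
    x - x        ≈⟨ -‿inverseʳ x ⟩
    0#           ∎)

  -- w bounds d for the sake of termination: d is replaced by inject₁ of its predecessor.
  det-alternating-< : ∀ w (d : Fin n) (k : Fin (suc n)) (M : Matrix ℝ (suc n)) → toℕ d ℕ.≤ w →
    toℕ k ℕ.≤ toℕ d → (∀ r → M r k ≈ M r (suc d)) → det ℝ M ≈ 0#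
  det-alternating-< w d k M d≤w k≤d equal with k Fin.≟ inject₁ d
  -- The equal columns are neighbours: swapping them leaves the matrix unchanged, so the determinant
  -- is its own negative.
  ... | yes ≡.refl = x≈-x⇒x≈0 (trans (det-cong fixed) (det-swap d M))
    where
    fixed : ∀ r c → M r c ≈ M r (swap d c)
    fixed r c with c Fin.≟ inject₁ d
    ... | yes ≡.refl = trans (equal r) (reflexive (≡.cong (M r) (≡.sym (swap-inject₁ d))))
    ... | no c≢d with c Fin.≟ suc d
    ...   | yes ≡.refl = trans (sym (equal r)) (reflexive (≡.cong (M r) (≡.sym (swap-suc d))))
    ...   | no c≢1+d = reflexive (≡.cong (M r) (≡.sym (swap-fixed d c c≢d c≢1+d)))
  det-alternating-< w zero zero M d≤w k≤d equal | no k≢d = contradiction ≡.refl k≢d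
  -- An adjacent swap brings the second of the equal columns one place nearer to `k`, at the cost of
  -- a sign.
  det-alternating-< (suc w) (suc d) k M (s≤s d≤w) k≤1+d equal | no k≢1+d = begin
    det ℝ M        ≈⟨ -‿involutive _ ⟨
    - - det ℝ M    ≈⟨ -‿cong (det-swap (suc d) M) ⟨
    - det ℝ M′     ≈⟨ -‿cong (det-alternating-< w (inject₁ d) k M′
                       (≡.subst (ℕ._≤ w) (≡.sym (Fin.toℕ-inject₁ d)) d≤w)
                       (≡.subst (toℕ k ℕ.≤_) (≡.sym (Fin.toℕ-inject₁ d)) k≤d) equal′) ⟩
    - 0#           ≈⟨ -0#≈0# ⟩
    0#             ∎
    where
    M′ : Matrix ℝ _
    M′ r c = M r (swap (suc d) c)
    k≤d : toℕ k ℕ.≤ toℕ d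
    k≤d = ℕ.≤-pred (ℕ.≤∧≢⇒< k≤1+d λ eq → k≢1+d (Fin.toℕ-injective
      (≡.trans eq (≡.sym (≡.cong suc (Fin.toℕ-inject₁ d))))))
    equal′ : ∀ r → M′ r k ≈ M′ r (suc (inject₁ d))
    equal′ r = trans
      (reflexive (≡.cong (M r) (swap-fixed (suc d) k k≢1+d λ { ≡.refl → ℕ.<-irrefl ≡.refl k≤1+d })))
      (trans (equal r) (reflexive (≡.cong (M r) (≡.sym (≡.cong suc (swap-inject₁ d))))))

  det-alternating : (M : Matrix ℝ n) {k l : Fin n} → k ≢ l → (∀ r → M r k ≈ M r l) → det ℝ M ≈ 0#
  det-alternating M {k} {l} k≢l equal with ℕ.<-cmp (toℕ k) (toℕ l)
  ... | tri≈ _ eq _ = contradiction (Fin.toℕ-injective eq) k≢l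
  det-alternating M {k} {suc d} k≢l equal | tri< k<l _ _ =
    det-alternating-< (toℕ d) d k M ℕ.≤-refl (ℕ.≤-pred k<l) equal
  det-alternating M {suc d} {l} k≢l equal | tri> _ _ l<k =
    det-alternating-< (toℕ d) d l M ℕ.≤-refl (ℕ.≤-pred l<k) (sym ∘ equal)

  infix 9 _[_]≔_
  _[_]≔_ : Matrix ℝ n → Fin n → (Fin n → Carrier) → Matrix ℝ n
  (M [ k ]≔ v) r c with c Fin.≟ k
  ... | yes _ = v r
  ... | no  _ = M r c

  []≔-same : (M : Matrix ℝ n) (k : Fin n) (v : Fin n → Carrier) → ∀ r → (M [ k ]≔ v) r k ≈ v r
  []≔-same M k v r with k Fin.≟ k
  ... | yes _  = refl
  ... | no k≢k = contradiction ≡.refl k≢k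

  []≔-other : (M : Matrix ℝ n) (k : Fin n) (v : Fin n → Carrier) → ∀ r c → c ≢ k → (M [ k ]≔ v) r c ≈ M r c
  []≔-other M k v r c c≢k with c Fin.≟ k
  ... | yes c≡k = contradiction c≡k c≢k
  ... | no _    = refl

  []≔-cong : (M : Matrix ℝ n) (k : Fin n) {u v : Fin n → Carrier} → (∀ r → u r ≈ v r) →
    ∀ r c → (M [ k ]≔ u) r c ≈ (M [ k ]≔ v) r c
  []≔-cong M k u≈v r c with c Fin.≟ k
  ... | yes _ = u≈v r
  ... | no  _ = refl

  det-[]≔-linear : (M : Matrix ℝ n) (k : Fin n) (a : Carrier) (u v : Fin n → Carrier) →
    det ℝ (M [ k ]≔ (λ r → a * u r + v r)) ≈ a * det ℝ (M [ k ]≔ u) + det ℝ (M [ k ]≔ v)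
  det-[]≔-linear M k a u v = det-linear k a
    (λ r → trans ([]≔-same M k _ r) (sym (+-cong (*-congˡ ([]≔-same M k u r)) ([]≔-same M k v r))))
    (λ r c c≢k → trans ([]≔-other M k _ r c c≢k) (sym ([]≔-other M k u r c c≢k)))
    (λ r c c≢k → trans ([]≔-other M k _ r c c≢k) (sym ([]≔-other M k v r c c≢k)))

  det-[]≔-sum : (M : Matrix ℝ n) (k : Fin n) (f : Fin m → Carrier) (V : Fin m → Fin n → Carrier) →
    det ℝ (M [ k ]≔ (λ r → sum λ l → f l * V l r)) ≈ sum λ l → f l * det ℝ (M [ k ]≔ V l)
  -- A zero column is `1#` times a zero column plus a zero column, so linearity gives x ≈ x + x for
  -- the determinant x.
  det-[]≔-sum {m = zero} M k f V = x≈1x+x⇒x≈0 (trans (sym (det-cong ([]≔-cong M k λ r →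
      trans (+-identityʳ _) (*-identityˡ 0#)))) (det-[]≔-linear M k 1# (λ _ → 0#) (λ _ → 0#)))
    where
    x≈1x+x⇒x≈0 : ∀ {x} → x ≈ 1# * x + x → x ≈ 0#
    x≈1x+x⇒x≈0 {x} eq = begin
      x                  ≈⟨ solve 1 (λ x → x := con (+ 1) :* x :+ x :- x) refl x ⟩
      1# * x + x - x     ≈⟨ +-congʳ eq ⟨
      x - x              ≈⟨ -‿inverseʳ x ⟩
      0#                 ∎
  det-[]≔-sum {m = suc m} M k f V = trans
    (det-[]≔-linear M k (f zero) (V zero) (λ r → sum λ l → f (suc l) * V (suc l) r))
    (+-congˡ (det-[]≔-sum M k (f ∘ suc) (V ∘ suc)))

  infixr 7 _⊛_
  _⊛_ : Matrix ℝ n → (Fin n → Carrier) → Fin n → Carrier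
  (M ⊛ f) i = sum λ j → M i j * f j

  basis : Fin n → Fin n → Carrier
  basis i j = diagonal ℝ (λ _ → 1#) i j

  diagonal-same : (d : Fin n → Carrier) (i : Fin n) → diagonal ℝ d i i ≈ d i
  diagonal-same d i with i Fin.≟ i
  ... | yes _  = refl
  ... | no i≢i = contradiction ≡.refl i≢i

  diagonal-other : (d : Fin n → Carrier) {i j : Fin n} → i ≢ j → diagonal ℝ d i j ≈ 0#
  diagonal-other d {i} {j} i≢j with i Fin.≟ j
  ... | yes i≡j = contradiction i≡j i≢j
  ... | no _    = refl

  -- The determinants on the left are the cofactors in row `k` of the adjugate. Replace column `k`
  -- of `M` by `M ⊛ f` and expand the determinant twice: over the basis vectors this gives the left
  -- side, and over the columns of `M` every term but the one for `k` has a repeated column.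
  cramer : (M : Matrix ℝ n) (k : Fin n) (f : Fin n → Carrier) →
    sum (λ j → det ℝ (M [ k ]≔ basis j) * (M ⊛ f) j) ≈ det ℝ M * f k
  cramer M k f = begin
    sum (λ j → det ℝ (M [ k ]≔ basis j) * (M ⊛ f) j)
      ≈⟨ sum-cong-≋ (λ j → *-comm (det ℝ (M [ k ]≔ basis j)) ((M ⊛ f) j)) ⟩
    sum (λ j → (M ⊛ f) j * det ℝ (M [ k ]≔ basis j))
      ≈⟨ det-[]≔-sum M k (M ⊛ f) basis ⟨
    det ℝ (M [ k ]≔ (λ r → sum λ j → (M ⊛ f) j * basis j r))
      ≈⟨ det-cong ([]≔-cong M k λ r → trans
           (sum-single _ r λ j j≢r → trans (*-congˡ (diagonal-other _ j≢r)) (zeroʳ _))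
           (trans (*-congˡ (diagonal-same _ r)) (*-identityʳ _))) ⟩
    det ℝ (M [ k ]≔ (M ⊛ f))
      ≈⟨ det-cong ([]≔-cong M k λ r → sum-cong-≋ λ l → *-comm (M r l) (f l)) ⟩
    det ℝ (M [ k ]≔ (λ r → sum λ l → f l * M r l))
      ≈⟨ det-[]≔-sum M k f (λ l r → M r l) ⟩
    sum (λ l → f l * det ℝ (M [ k ]≔ (λ r → M r l)))
      ≈⟨ sum-single _ k (λ l l≢k → trans (*-congˡ (repeated l≢k)) (zeroʳ _)) ⟩
    f k * det ℝ (M [ k ]≔ (λ r → M r k))
      ≈⟨ *-congˡ (det-cong unchanged) ⟩
    f k * det ℝ M
      ≈⟨ *-comm _ _ ⟩
    det ℝ M * f k ∎
    where
    repeated : ∀ {l} → l ≢ k → det ℝ (M [ k ]≔ (λ r → M r l)) ≈ 0#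
    repeated {l} l≢k = det-alternating (M [ k ]≔ _) l≢k λ r →
      trans ([]≔-other M k _ r l l≢k) (sym ([]≔-same M k _ r))
    unchanged : ∀ r c → (M [ k ]≔ (λ r → M r k)) r c ≈ M r c
    unchanged r c with c Fin.≟ k
    ... | yes ≡.refl = refl
    ... | no _       = refl

  -- Polynomial functions and the Cayley–Hamilton theorem

  -- Functions with vanishing divided differences of order d, that is,
  -- polynomial functions of degree less than d.
  data Pol : ℕ → (Carrier → Carrier) → Set (c ⊔ ℓ₁) where
    vanishing : ∀ {f} → (∀ x → f x ≈ 0#) → Pol zero f
    divisible : ∀ {d f} → (∀ a → ∃[ g ] Pol d g × (∀ x → f x ≈ f a + (x - a) * g x)) → Pol (suc d) f

  divide : ∀ {d f} → Pol (suc d) f → ∀ a → ∃[ g ] Pol d g × (∀ x → f x ≈ f a + (x - a) * g x)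
  divide (divisible pf) = pf

  vanish : ∀ {f} → Pol zero f → ∀ x → f x ≈ 0#
  vanish (vanishing f≈0) = f≈0

  Affine : (Carrier → Carrier) → Set (c ⊔ ℓ₁)
  Affine f = ∃[ p ] ∃[ q ] ∀ x → f x ≈ p * x + q

  Pol-cong : ∀ {f g} → (∀ x → f x ≈ g x) → Pol d f → Pol d g
  Pol-cong f≈g (vanishing f≈0) = vanishing λ x → trans (sym (f≈g x)) (f≈0 x)
  Pol-cong f≈g (divisible pf) = divisible λ a → let h , ph , eq = pf a in
    h , ph , λ x → trans (sym (f≈g x)) (trans (eq x) (+-congʳ (f≈g a)))

  Pol-0 : ∀ d → Pol d (λ _ → 0#)
  Pol-0 zero    = vanishing λ _ → refl
  Pol-0 (suc d) = divisible λ a → (λ _ → 0#) , Pol-0 d ,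
    λ x → solve 2 (λ x a → con (+ 0) := con (+ 0) :+ (x :- a) :* con (+ 0)) refl x a

  Pol-const : ∀ d b → Pol (suc d) (λ _ → b)
  Pol-const d b = divisible λ a → (λ _ → 0#) , Pol-0 d ,
    λ x → solve 3 (λ x a b → b := b :+ (x :- a) :* con (+ 0)) refl x a b

  Pol-+ : ∀ {f g} → Pol d f → Pol d g → Pol d (λ x → f x + g x)
  Pol-+ (vanishing f≈0) (vanishing g≈0) = vanishing λ x → trans (+-cong (f≈0 x) (g≈0 x)) (+-identityˡ 0#)
  Pol-+ (divisible pf) (divisible pg) = divisible λ a →
    let f′ , pf′ , eqf = pf a
        g′ , pg′ , eqg = pg a in
    (λ x → f′ x + g′ x) , Pol-+ pf′ pg′ ,
    λ x → trans (+-cong (eqf x) (eqg x))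
      (solve 6 (λ x a p q r s → p :+ (x :- a) :* q :+ (r :+ (x :- a) :* s) :=
                                p :+ r :+ (x :- a) :* (q :+ s)) refl x a _ _ _ _)

  Pol-* : ∀ b {f} → Pol d f → Pol d (λ x → b * f x)
  Pol-* b (vanishing f≈0) = vanishing λ x → trans (*-congˡ (f≈0 x)) (zeroʳ b)
  Pol-* b (divisible pf) = divisible λ a → let f′ , pf′ , eq = pf a in
    (λ x → b * f′ x) , Pol-* b pf′ ,
    λ x → trans (*-congˡ (eq x))
      (solve 5 (λ x a b p q → b :* (p :+ (x :- a) :* q) := b :* p :+ (x :- a) :* (b :* q)) refl x a b _ _)

  Pol-sum : (f : Fin n → Carrier → Carrier) → (∀ i → Pol d (f i)) → Pol d (λ x → sum λ i → f i x)
  Pol-sum {zero}  f pf = Pol-0 _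
  Pol-sum {suc n} f pf = Pol-+ (pf zero) (Pol-sum (f ∘ suc) (pf ∘ suc))

  Pol-affine-* : ∀ {l f} → Affine l → Pol d f → Pol (suc d) (λ x → l x * f x)
  Pol-affine-* aff (vanishing f≈0) = Pol-cong (λ x → sym (trans (*-congˡ (f≈0 x)) (zeroʳ _))) (Pol-0 1)
  Pol-affine-* {suc d} {l} {f} aff@(p , q , eql) (divisible pf) = divisible λ a →
    let g , pg , eqf = pf a in
    -- The product rule for divided differences: the slope `p` of `l` times `f a`, plus `l` times
    -- the divided difference of `f`.
    (λ x → p * f a + l x * g x) ,
    Pol-+ (Pol-const d (p * f a)) (Pol-affine-* aff pg) , λ x → begin
      l x * f x                          ≈⟨ *-congˡ (eqf x) ⟩
      l x * (f a + (x - a) * g x)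
        ≈⟨ solve 5 (λ l x a u v → l :* (u :+ (x :- a) :* v) := l :* u :+ (x :- a) :* (l :* v)) refl _ _ _ _ _ ⟩
      l x * f a + (x - a) * (l x * g x)  ≈⟨ +-congʳ (*-congʳ (eql x)) ⟩
      (p * x + q) * f a + (x - a) * (l x * g x)
        ≈⟨ solve 6 (λ p q x a u w → (p :* x :+ q) :* u :+ (x :- a) :* w :=
                                    (p :* a :+ q) :* u :+ (x :- a) :* (p :* u :+ w)) refl _ _ _ _ _ _ ⟩
      (p * a + q) * f a + (x - a) * (p * f a + l x * g x)  ≈⟨ +-congʳ (*-congʳ (eql a)) ⟨
      l a * f a + (x - a) * (p * f a + l x * g x)          ∎

  Pol-product : (a : Fin m → Carrier) → Pol (suc m) (λ x → product λ i → x - a i)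
  Pol-product {zero}  a = Pol-const 0 1#
  Pol-product {suc m} a = Pol-affine-* (1# , - a zero , λ x → +-congʳ (sym (*-identityˡ x))) (Pol-product (a ∘ suc))

  Pol-det : (M : Fin n → Fin n → Carrier → Carrier) → (∀ r c → Affine (M r c)) →
    Pol (suc n) (λ x → det ℝ λ r c → M r c x)
  Pol-det {zero}  M aff = Pol-const 0 1#
  Pol-det {suc n} M aff = Pol-sum _ λ j → Pol-cong
    (λ x → solve 3 (λ s u v → u :* (s :* v) := s :* u :* v) refl (sign j) _ _)
    (Pol-affine-* (aff zero j) (Pol-* (sign j) (Pol-det _ λ r c → aff (suc r) (punchIn j c))))

  -- The constant column contributes no factor of x, so the degree stays below `n`. Cofactors of x -
  -- L are of this kind, and `n` divisions therefore exhaust them.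
  Pol-det-constant-column : (k : Fin n) (v : Fin n → Carrier) (M : Fin n → Fin n → Carrier → Carrier) →
    (∀ r x → M r k x ≈ v r) → (∀ r c → c ≢ k → Affine (M r c)) →
    Pol n (λ x → det ℝ λ r c → M r c x)
  Pol-det-constant-column {suc n} k v M const aff = Pol-sum _ term
    where
    term : ∀ j → Pol (suc n) (λ x → sign j * M zero j x * det ℝ (λ r c → M (suc r) (punchIn j c) x))
    term j with j Fin.≟ k
    ... | yes ≡.refl = Pol-cong (λ x → *-congʳ (*-congˡ (sym (const zero x))))
      (Pol-* (sign j * v zero) (Pol-det _ λ r c → aff (suc r) (punchIn j c) (Fin.punchInᵢ≢i j c)))
    ... | no j≢k = Pol-cong
      (λ x → solve 3 (λ s u v → u :* (s :* v) := s :* u :* v) refl (sign j) _ _)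
      (Pol-affine-* (aff zero j j≢k) (Pol-* (sign j)
        (Pol-det-constant-column k′ (v ∘ suc) _
          (λ r x → trans (reflexive (≡.cong (λ l → M (suc r) l x) k≡)) (const (suc r) x))
          λ r c c≢k′ → aff (suc r) (punchIn j c) λ eq →
            c≢k′ (Fin.punchIn-injective j c k′ (≡.trans eq (≡.sym k≡))))))
      where
      k′ = punchOut j≢k
      k≡ : punchIn j k′ ≡ k
      k≡ = Fin.punchIn-punchOut j≢k

  -- Dividing by `x - y 0` keeps all later zeros, because the differences there are invertible. An
  -- infinite sequence of zeros spares counting: its tail serves the induction.
  Pol-vanish : ∀ {f} → Pol d f → (y : ℕ → Carrier) → (∀ {i j} → i ℕ.< j → y j - y i # 0#) →
    (∀ i → f (y i) ≈ 0#) → ∀ x → f x ≈ 0#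
  Pol-vanish (vanishing f≈0) y y# fy≈0 = f≈0
  Pol-vanish {f = f} (divisible pf) y y# fy≈0 x with pf (y 0)
  ... | g , pg , eq = begin
    f x                       ≈⟨ f≈ x ⟩
    (x - y 0) * g x           ≈⟨ *-congˡ (Pol-vanish pg (y ∘ suc) (y# ∘ s≤s) g≈0 x) ⟩
    (x - y 0) * 0#            ≈⟨ zeroʳ _ ⟩
    0#                        ∎
    where
    f≈ : ∀ x → f x ≈ (x - y 0) * g x
    f≈ x = trans (eq x) (trans (+-congʳ (fy≈0 0)) (+-identityˡ _))
    g≈0 : ∀ i → g (y (suc i)) ≈ 0#
    g≈0 i = #0-cancel (y# (s≤s z≤n)) (trans (sym (f≈ _)) (fy≈0 (suc i)))

  -- The factor `x - a` cannot be inverted at `a`, but it can at the points a + 1, a + 2, ..., and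
  -- vanishing there forces a polynomial function to vanish everywhere, including at `a`.
  Pol-cancel : ∀ {f} a → Pol d f → (∀ x → (x - a) * f x ≈ 0#) → ∀ x → f x ≈ 0#
  Pol-cancel {f = f} a pf eq = Pol-vanish pf (λ i → a + fromℕ (suc i))
    (λ {i} {j} i<j → #-congʳ (solve 3 (λ a u v → v :- u := a :+ v :- (a :+ u)) refl a _ _)
      (<⇒-#0 (fromℕ-mono-< (s≤s i<j))))
    (λ i → #0-cancel (#-congʳ (solve 2 (λ a u → u := a :+ u :- a) refl a _)
      (#-sym (<⇒# (0<fromℕ i)))) (eq _))

  -- The commuting operators a - L and their product over the eigenvalues

  module _ {n} (L : Matrix ℝ n) where

    shift : Carrier → (Fin n → Carrier) → Fin n → Carrier
    shift a f i = a * f i - (L ⊛ f) i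

    shifts : (Fin m → Carrier) → (Fin n → Carrier) → Fin n → Carrier
    shifts {zero}  a f = f
    shifts {suc m} a f = shifts (a ∘ suc) (shift (a zero) f)

    ⊛-cong : ∀ {f g} → (∀ i → f i ≈ g i) → ∀ i → (L ⊛ f) i ≈ (L ⊛ g) i
    ⊛-cong f≈g i = sum-cong-≋ λ j → *-congˡ (f≈g j)

    ⊛-linear : ∀ a f g i → (L ⊛ (λ j → a * f j + g j)) i ≈ a * (L ⊛ f) i + (L ⊛ g) i
    ⊛-linear a f g i = trans
      (sum-cong-≋ λ j → solve 4 (λ l a u v → l :* (a :* u :+ v) := a :* (l :* u) :+ l :* v)
        refl (L i j) a (f j) (g j))
      (sum-linear a (λ j → L i j * f j) (λ j → L i j * g j))

    ⊛-shift : ∀ a f i → (L ⊛ shift a f) i ≈ shift a (L ⊛ f) i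
    ⊛-shift a f i = begin
      (L ⊛ shift a f) i
        ≈⟨ ⊛-cong (λ j → solve 2 (λ x y → x :- y := con -[1+ 0 ] :* y :+ x) refl _ _) i ⟩
      (L ⊛ (λ j → - 1# * (L ⊛ f) j + a * f j)) i   ≈⟨ ⊛-linear (- 1#) (L ⊛ f) (λ j → a * f j) i ⟩
      - 1# * (L ⊛ (L ⊛ f)) i + (L ⊛ (λ j → a * f j)) i
        ≈⟨ +-congˡ (trans (sum-cong-≋ λ j → solve 3 (λ l a u → l :* (a :* u) := a :* (l :* u)) refl (L i j) a (f j))
             (sym (*-distribˡ-sum a (λ j → L i j * f j)))) ⟩
      - 1# * (L ⊛ (L ⊛ f)) i + a * (L ⊛ f) i       ≈⟨ solve 2 (λ x y → con -[1+ 0 ] :* x :+ y := y :- x) refl _ _ ⟩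
      shift a (L ⊛ f) i                            ∎

    shift-cong : ∀ a {f g} → (∀ i → f i ≈ g i) → ∀ i → shift a f i ≈ shift a g i
    shift-cong a f≈g i = +-cong (*-congˡ (f≈g i)) (-‿cong (⊛-cong f≈g i))

    shift-comm : ∀ a b f i → shift a (shift b f) i ≈ shift b (shift a f) i
    shift-comm a b f i = begin
      a * (b * f i - (L ⊛ f) i) - (L ⊛ shift b f) i
        ≈⟨ +-congˡ (-‿cong (⊛-shift b f i)) ⟩
      a * (b * f i - (L ⊛ f) i) - (b * (L ⊛ f) i - (L ⊛ (L ⊛ f)) i)
        ≈⟨ solve 5 (λ a b x y z → a :* (b :* x :- y) :- (b :* y :- z) := b :* (a :* x :- y) :- (a :* y :- z))
             refl a b _ _ _ ⟩
      b * (a * f i - (L ⊛ f) i) - (a * (L ⊛ f) i - (L ⊛ (L ⊛ f)) i)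
        ≈⟨ +-congˡ (-‿cong (⊛-shift a f i)) ⟨
      b * (a * f i - (L ⊛ f) i) - (L ⊛ shift a f) i ∎

    -- Divide the adjugate rows β successively by x - a i; the class U shrinks
    -- to the image of the shifts already performed.
    adjugate⇒annihilates : ∀ {m} (a : Fin m → Carrier) (k : Fin n) (β : Fin n → Carrier → Carrier) →
      (∀ j → Pol m (β j)) →
      (U : (Fin n → Carrier) → Set (c ⊔ ℓ₁)) → (∀ b {f} → U f → U (shift b f)) →
      (∀ {f} → U f → ∀ x → sum (λ j → β j x * shift x f j) ≈ (product λ i → x - a i) * f k) →
      ∀ {f} → U f → shifts a f k ≈ 0#
    -- No factors remain: the rows are zero and the product is `1#`, so the identity reads 0 =
    -- `f k`.
    adjugate⇒annihilates {zero} a k β pβ U closed eq {f} uf = begin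
      f k                                ≈⟨ *-identityˡ _ ⟨
      1# * f k                           ≈⟨ eq uf 0# ⟨
      sum (λ j → β j 0# * shift 0# f j)  ≈⟨ sum-zero _ (λ j → trans (*-congʳ (vanish (pβ j) 0#)) (zeroˡ _)) ⟩
      0#                                 ∎
    adjugate⇒annihilates {suc m} a k β pβ U closed eq {f} uf =
      adjugate⇒annihilates (a ∘ suc) k β′ (λ j → proj₁ (proj₂ (divide (pβ j) a₀)))
        U′ closed′ eq′ (closed a₀ uf , f , uf , λ i → refl)
      where
      a₀ = a zero
      β′ : Fin n → Carrier → Carrier
      β′ j = proj₁ (divide (pβ j) a₀)
      β≈ : ∀ j x → β j x ≈ β j a₀ + (x - a₀) * β′ j x
      β≈ j = proj₂ (proj₂ (divide (pβ j) a₀))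
      -- The preimage `g` is kept in `U`, so that the old identity can be evaluated for it at the
      -- root `a₀`.
      U′ : (Fin n → Carrier) → Set (c ⊔ ℓ₁)
      U′ f = U f × ∃[ g ] U g × (∀ i → f i ≈ shift a₀ g i)
      closed′ : ∀ b {f} → U′ f → U′ (shift b f)
      closed′ b (uf , g , ug , f≈) = closed b uf , shift b g , closed b ug ,
        λ i → trans (shift-cong b f≈ i) (shift-comm b a₀ g i)
      P′ : Carrier → Carrier
      P′ x = product λ i → x - a (suc i)
      at-root : ∀ {g} → U g → sum (λ j → β j a₀ * shift a₀ g j) ≈ 0#
      at-root {g} ug = trans (eq ug a₀) (trans (*-congʳ (*-congʳ (-‿inverseʳ a₀)))
        (solve 2 (λ x y → con (+ 0) :* x :* y := con (+ 0)) refl _ _))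
      module _ {f} (uf : U f) where
        R : Carrier → Carrier
        R x = sum λ j → β j a₀ * f j + β′ j x * shift x f j
        split : ∀ x → sum (λ j → β j x * shift x f j) ≈ (x - a₀) * R x
        split x = begin
          sum (λ j → β j x * shift x f j)
            ≈⟨ sum-cong-≋ (λ j → trans (*-congʳ (β≈ j x))
                 (solve 6 (λ b b′ x a f l → (b :+ (x :- a) :* b′) :* (x :* f :- l) :=
                     (x :- a) :* (b :* f :+ b′ :* (x :* f :- l)) :+ b :* (a :* f :- l))
                   refl (β j a₀) (β′ j x) x a₀ (f j) ((L ⊛ f) j))) ⟩
          sum (λ j → (x - a₀) * (β j a₀ * f j + β′ j x * shift x f j) + β j a₀ * shift a₀ f j)
            ≈⟨ sum-linear (x - a₀) (λ j → β j a₀ * f j + β′ j x * shift x f j) _ ⟩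
          (x - a₀) * R x + sum (λ j → β j a₀ * shift a₀ f j)
            ≈⟨ +-congˡ (at-root uf) ⟩
          (x - a₀) * R x + 0#
            ≈⟨ +-identityʳ _ ⟩
          (x - a₀) * R x ∎
        -- Both sides of the old identity carry the factor `x - a₀`. Their cofactors agree at `a₀`
        -- too, because the difference is a polynomial function and `Pol-cancel` applies.
        quotient : ∀ x → P′ x * f k + - 1# * R x ≈ 0#
        quotient = Pol-cancel a₀
          (Pol-+ (Pol-cong (λ x → *-comm (f k) (P′ x)) (Pol-* (f k) (Pol-product (a ∘ suc))))
            (Pol-* (- 1#) (Pol-sum _ λ j → Pol-+ (Pol-const m (β j a₀ * f j))
              (Pol-cong (λ x → *-comm (shift x f j) (β′ j x))
                (Pol-affine-* (f j , - (L ⊛ f) j , λ x → +-congʳ (*-comm x (f j)))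
                  (proj₁ (proj₂ (divide (pβ j) a₀))))))))
          λ x → begin
            (x - a₀) * (P′ x * f k + - 1# * R x)
              ≈⟨ solve 4 (λ u p f r → u :* (p :* f :+ con -[1+ 0 ] :* r) := u :* p :* f :- u :* r)
                   refl (x - a₀) (P′ x) (f k) (R x) ⟩
            (x - a₀) * P′ x * f k - (x - a₀) * R x
              ≈⟨ x≈y⇒x-y≈0 (trans (sym (eq uf x)) (split x)) ⟩
            0# ∎
      eq′ : ∀ {f} → U′ f → ∀ x → sum (λ j → β′ j x * shift x f j) ≈ P′ x * f k
      eq′ {f} (uf , g , ug , f≈) x = sym (begin
        P′ x * f k
          ≈⟨ x-y≈0⇒x≈y (trans (+-congˡ (solve 1 (λ r → :- r := con -[1+ 0 ] :* r) refl _)) (quotient uf x)) ⟩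
        sum (λ j → β j a₀ * f j + β′ j x * shift x f j)
          ≈⟨ ∑-distrib-+ (λ j → β j a₀ * f j) _ ⟩
        sum (λ j → β j a₀ * f j) + sum (λ j → β′ j x * shift x f j)
          -- The remainder of the division vanishes exactly because `f` is the image of `g` under
          -- `shift a₀`.
          ≈⟨ +-congʳ (trans (sum-cong-≋ λ j → *-congˡ (f≈ j)) (at-root ug)) ⟩
        0# + sum (λ j → β′ j x * shift x f j)
          ≈⟨ +-identityˡ _ ⟩
        sum (λ j → β′ j x * shift x f j) ∎)

    charMatrix-⊛ : ∀ x f i → ((_⊖_ ℝ (diagonal ℝ λ _ → x) L) ⊛ f) i ≈ shift x f i
    charMatrix-⊛ x f i = begin
      sum (λ j → (diagonal ℝ (λ _ → x) i j - L i j) * f j)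
        ≈⟨ sum-cong-≋ (λ j → solve 3 (λ d l u → (d :- l) :* u := con -[1+ 0 ] :* (l :* u) :+ d :* u)
             refl _ (L i j) (f j)) ⟩
      sum (λ j → - 1# * (L i j * f j) + diagonal ℝ (λ _ → x) i j * f j)
        ≈⟨ sum-linear (- 1#) (λ j → L i j * f j) _ ⟩
      - 1# * (L ⊛ f) i + sum (λ j → diagonal ℝ (λ _ → x) i j * f j)
        ≈⟨ +-congˡ (sum-single _ i λ j j≢i → trans (*-congʳ (diagonal-other _ (j≢i ∘ ≡.sym))) (zeroˡ _)) ⟩
      - 1# * (L ⊛ f) i + diagonal ℝ (λ _ → x) i i * f i
        ≈⟨ +-congˡ (*-congʳ (diagonal-same _ i)) ⟩
      - 1# * (L ⊛ f) i + x * f i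
        ≈⟨ solve 2 (λ l y → con -[1+ 0 ] :* l :+ y := y :- l) refl _ _ ⟩
      shift x f i ∎

    -- The division starts from row `k` of the adjugate of x - L, with `U` the class of all vectors.
    cayley-hamilton : (ev : Fin n → Carrier) → (∀ x → charPoly ℝ L x ≈ product λ i → x - ev i) →
      ∀ f i → shifts ev f i ≈ 0#
    cayley-hamilton ev roots f k = adjugate⇒annihilates ev k β pβ (λ _ → 𝟙) (λ _ _ → tt)
      (λ {f} _ x → trans (sum-cong-≋ λ j → *-congˡ (sym (charMatrix-⊛ x f j)))
        (trans (cramer (N x) k f) (*-congʳ (roots x)))) tt
      where
      N : Carrier → Matrix ℝ n
      N x = _⊖_ ℝ (diagonal ℝ λ _ → x) L
      β : Fin n → Carrier → Carrier
      β j x = det ℝ (N x [ k ]≔ basis j)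
      affine : ∀ r c → Affine (λ x → N x r c)
      affine r c with r Fin.≟ c
      ... | yes _ = 1# , - L r c , λ x → +-congʳ (sym (*-identityˡ x))
      ... | no  _ = 0# , 0# - L r c , λ x → sym (trans (+-congʳ (zeroˡ x)) (+-identityˡ _))
      pβ : ∀ j → Pol n (β j)
      pβ j = Pol-det-constant-column k (basis j) _ (λ r x → []≔-same (N x) k (basis j) r)
        λ r c c≢k → let p , q , eq = affine r c in
          p , q , λ x → trans ([]≔-other (N x) k (basis j) r c c≢k) (eq x)

  -- Rayleigh quotients

  sum-combination : ∀ p q (f g : Fin n → Carrier) → sum (λ i → p * f i + q * g i) ≈ p * sum f + q * sum g
  sum-combination p q f g = trans (sum-linear p f _) (+-congˡ (sym (*-distribˡ-sum q g)))

  ⟨_,_⟩ : (Fin n → Carrier) → (Fin n → Carrier) → Carrier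
  ⟨ f , g ⟩ = sum λ i → f i * g i

  ⟨,⟩-congʳ : (f : Fin n → Carrier) {g h : Fin n → Carrier} → (∀ i → g i ≈ h i) → ⟨ f , g ⟩ ≈ ⟨ f , h ⟩
  ⟨,⟩-congʳ f g≈h = sum-cong-≋ λ i → *-congˡ (g≈h i)

  ⟨,⟩-comm : (f g : Fin n → Carrier) → ⟨ f , g ⟩ ≈ ⟨ g , f ⟩
  ⟨,⟩-comm f g = sum-cong-≋ λ i → *-comm (f i) (g i)

  ⟨,⟩-combinationʳ : ∀ p q (f g h : Fin n → Carrier) →
    ⟨ f , (λ i → p * g i + q * h i) ⟩ ≈ p * ⟨ f , g ⟩ + q * ⟨ f , h ⟩
  ⟨,⟩-combinationʳ p q f g h = trans
    (sum-cong-≋ λ i → solve 5 (λ p q f g h → f :* (p :* g :+ q :* h) := p :* (f :* g) :+ q :* (f :* h))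
      refl p q (f i) (g i) (h i))
    (sum-combination p q (λ i → f i * g i) (λ i → f i * h i))

  ⟨,⟩-combinationˡ : ∀ p q (f g h : Fin n → Carrier) →
    ⟨ (λ i → p * g i + q * h i) , f ⟩ ≈ p * ⟨ g , f ⟩ + q * ⟨ h , f ⟩
  ⟨,⟩-combinationˡ p q f g h = trans (⟨,⟩-comm _ f) (trans (⟨,⟩-combinationʳ p q f g h)
    (+-cong (*-congˡ (⟨,⟩-comm f g)) (*-congˡ (⟨,⟩-comm f h))))

  ⟨,⟩-*ʳ : ∀ p (f g : Fin n → Carrier) → ⟨ f , (λ i → p * g i) ⟩ ≈ p * ⟨ f , g ⟩
  ⟨,⟩-*ʳ p f g = trans (sum-cong-≋ λ i → solve 3 (λ p f g → f :* (p :* g) := p :* (f :* g)) refl p (f i) (g i))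
    (sym (*-distribˡ-sum p (λ i → f i * g i)))

  ⟨f,f⟩≈0⇒f≈0 : (f : Fin n → Carrier) → ⟨ f , f ⟩ ≈ 0# → ∀ i → f i ≈ 0#
  ⟨f,f⟩≈0⇒f≈0 f eq i = x²≈0⇒x≈0 (sum≈0⇒≈0 (λ i → f i * f i) (λ i → 0≤x² (f i)) eq i)

  module _ {n} (L : Matrix ℝ n) where

    ⊛-combination : ∀ p q f g i → (L ⊛ (λ j → p * f j + q * g j)) i ≈ p * (L ⊛ f) i + q * (L ⊛ g) i
    ⊛-combination p q f g i = ⟨,⟩-combinationʳ p q (L i) f g

    shift-combination : ∀ a p q f g i →
      shift L a (λ j → p * f j + q * g j) i ≈ p * shift L a f i + q * shift L a g i
    shift-combination a p q f g i = trans (+-congˡ (-‿cong (⊛-combination p q f g i)))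
      (solve 7 (λ a p q f g u v → a :* (p :* f :+ q :* g) :- (p :* u :+ q :* v) :=
                                  p :* (a :* f :- u) :+ q :* (a :* g :- v)) refl a p q _ _ _ _)

    shifts-cong : (a : Fin m → Carrier) {f g : Fin n → Carrier} → (∀ i → f i ≈ g i) →
      ∀ i → shifts L a f i ≈ shifts L a g i
    shifts-cong {zero}  a f≈g = f≈g
    shifts-cong {suc m} a f≈g = shifts-cong (a ∘ suc) (shift-cong L (a zero) f≈g)

    shifts-combination : (a : Fin m → Carrier) → ∀ p q f g i →
      shifts L a (λ j → p * f j + q * g j) i ≈ p * shifts L a f i + q * shifts L a g i
    shifts-combination {zero}  a p q f g i = refl
    shifts-combination {suc m} a p q f g i = trans
      (shifts-cong (a ∘ suc) (shift-combination (a zero) p q f g) i)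
      (shifts-combination (a ∘ suc) p q _ _ i)

    shift-shifts : (a : Fin m → Carrier) → ∀ b f i → shift L b (shifts L a f) i ≈ shifts L a (shift L b f) i
    shift-shifts {zero}  a b f i = refl
    shift-shifts {suc m} a b f i = trans (shift-shifts (a ∘ suc) b _ i)
      (shifts-cong (a ∘ suc) (shift-comm L b (a zero) f) i)

    shift-eigen : ∀ a μ {g} → (∀ i → (L ⊛ g) i ≈ μ * g i) → ∀ i → shift L a g i ≈ (a - μ) * g i
    shift-eigen a μ {g} Lg≈μg i = trans (+-congˡ (-‿cong (Lg≈μg i)))
      (solve 3 (λ a μ g → a :* g :- μ :* g := (a :- μ) :* g) refl a μ (g i))

    ⊛-* : ∀ p f i → (L ⊛ (λ j → p * f j)) i ≈ p * (L ⊛ f) i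
    ⊛-* p f i = ⟨,⟩-*ʳ p (L i) f

    shifts-eigen : (a : Fin m → Carrier) → ∀ μ {g} → (∀ i → (L ⊛ g) i ≈ μ * g i) →
      ∀ i → shifts L a g i ≈ (product λ j → a j - μ) * g i
    shifts-eigen {zero}  a μ {g} Lg≈μg i = sym (*-identityˡ _)
    shifts-eigen {suc m} a μ {g} Lg≈μg i = begin
      shifts L (a ∘ suc) (shift L (a zero) g) i
        ≈⟨ shifts-eigen (a ∘ suc) μ {shift L (a zero) g} (λ j → begin
             (L ⊛ shift L (a zero) g) j          ≈⟨ ⊛-cong L (shift-eigen (a zero) μ Lg≈μg) j ⟩
             (L ⊛ (λ l → (a zero - μ) * g l)) j  ≈⟨ ⊛-* (a zero - μ) g j ⟩
             (a zero - μ) * (L ⊛ g) j            ≈⟨ *-congˡ (Lg≈μg j) ⟩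
             (a zero - μ) * (μ * g j)
               ≈⟨ solve 3 (λ d μ g → d :* (μ :* g) := μ :* (d :* g)) refl _ μ (g j) ⟩
             μ * ((a zero - μ) * g j)            ≈⟨ *-congˡ (shift-eigen (a zero) μ Lg≈μg j) ⟨
             μ * shift L (a zero) g j            ∎) i ⟩
      P′ * shift L (a zero) g i      ≈⟨ *-congˡ (shift-eigen (a zero) μ Lg≈μg i) ⟩
      P′ * ((a zero - μ) * g i)      ≈⟨ solve 3 (λ p d g → p :* (d :* g) := d :* p :* g) refl P′ _ (g i) ⟩
      (a zero - μ) * P′ * g i        ∎
      where
      P′ = product λ j → a (suc j) - μ

    module _ (L-sym : ∀ i j → L i j ≈ L j i) where

      ⊛-selfAdjoint : ∀ f g → ⟨ L ⊛ f , g ⟩ ≈ ⟨ f , L ⊛ g ⟩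
      ⊛-selfAdjoint f g = begin
        sum (λ i → sum (λ j → L i j * f j) * g i)
          ≈⟨ sum-cong-≋ (λ i → *-distribʳ-sum (g i) (λ j → L i j * f j)) ⟩
        sum (λ i → sum (λ j → L i j * f j * g i))
          ≈⟨ ∑-comm (λ i j → L i j * f j * g i) ⟩
        sum (λ j → sum (λ i → L i j * f j * g i))
          ≈⟨ sum-cong-≋ (λ j → sum-cong-≋ λ i → trans (*-congʳ (*-congʳ (L-sym i j)))
               (solve 3 (λ l f g → l :* f :* g := f :* (l :* g)) refl (L j i) (f j) (g i))) ⟩
        sum (λ j → sum (λ i → f j * (L j i * g i)))
          ≈⟨ sum-cong-≋ (λ j → *-distribˡ-sum (f j) (λ i → L j i * g i)) ⟨
        ⟨ f , L ⊛ g ⟩ ∎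

      ⟨,shift⟩ : ∀ a f g → ⟨ f , shift L a g ⟩ ≈ a * ⟨ f , g ⟩ + - 1# * ⟨ f , L ⊛ g ⟩
      ⟨,shift⟩ a f g = trans
        (⟨,⟩-congʳ f λ i → solve 3 (λ a g l → a :* g :- l := a :* g :+ con -[1+ 0 ] :* l) refl a (g i) ((L ⊛ g) i))
        (⟨,⟩-combinationʳ a (- 1#) f g (L ⊛ g))

      shift-selfAdjoint : ∀ a f g → ⟨ shift L a f , g ⟩ ≈ ⟨ f , shift L a g ⟩
      shift-selfAdjoint a f g = begin
        ⟨ shift L a f , g ⟩                      ≈⟨ ⟨,⟩-comm (shift L a f) g ⟩
        ⟨ g , shift L a f ⟩                      ≈⟨ ⟨,shift⟩ a g f ⟩
        a * ⟨ g , f ⟩ + - 1# * ⟨ g , L ⊛ f ⟩    ≈⟨ +-cong (*-congˡ (⟨,⟩-comm g f))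
                                                     (*-congˡ (trans (⟨,⟩-comm g (L ⊛ f)) (⊛-selfAdjoint f g))) ⟩
        a * ⟨ f , g ⟩ + - 1# * ⟨ f , L ⊛ g ⟩    ≈⟨ ⟨,shift⟩ a f g ⟨
        ⟨ f , shift L a g ⟩                      ∎

      shifts-selfAdjoint : (a : Fin m → Carrier) → ∀ f g → ⟨ shifts L a f , g ⟩ ≈ ⟨ f , shifts L a g ⟩
      shifts-selfAdjoint {zero}  a f g = refl
      shifts-selfAdjoint {suc m} a f g = begin
        ⟨ shifts L (a ∘ suc) (shift L (a zero) f) , g ⟩  ≈⟨ shifts-selfAdjoint (a ∘ suc) _ g ⟩
        ⟨ shift L (a zero) f , shifts L (a ∘ suc) g ⟩    ≈⟨ shift-selfAdjoint (a zero) f _ ⟩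
        ⟨ f , shift L (a zero) (shifts L (a ∘ suc) g) ⟩  ≈⟨ ⟨,⟩-congʳ f (shift-shifts (a ∘ suc) (a zero) g) ⟩
        ⟨ f , shifts L a g ⟩                             ∎

      -- With g = Π_{i>0} (aᵢ − L) f an eigenvector for a₀ and t = Π_{i>0} (aᵢ − a₀),
      -- t ⟨f,g⟩ = ⟨g,g⟩; so t = 0 forces g = 0, and otherwise t f splits
      -- orthogonally into g and a vector annihilated by the remaining factors.
      rayleigh-lower-bound : (a : Fin m → Carrier) → ∀ μ → (∀ i → μ ≤ a i) → ∀ f →
        (∀ i → shifts L a f i ≈ 0#) → ⟨ f , shift L μ f ⟩ ≤ 0#
      rayleigh-lower-bound {zero} a μ μ≤a f f≈0 =
        ≤-reflexive (sum-zero _ λ i → trans (*-congʳ (f≈0 i)) (zeroˡ _))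
      rayleigh-lower-bound {suc m} a μ μ≤a f annihilated = by-zero-cases t
        (λ t≈0 → rayleigh-lower-bound a′ μ (μ≤a ∘ suc) f
          (⟨f,f⟩≈0⇒f≈0 g (trans (sym t⟨f,g⟩) (trans (*-congʳ t≈0) (zeroˡ _)))))
        λ t#0 → *-cancel-≤ (#0⇒0<x² t#0) (≤-respˡ (sym t²-expansion) (≤-respʳ
          (trans (+-identityʳ 0#) (sym (zeroʳ _)))
          (+-mono-≤ (rayleigh-lower-bound a′ μ (μ≤a ∘ suc) h h-annihilated)
            (≤-respʳ (zeroʳ _) (≤-respˡ (*-comm _ _)
              (*-monoʳ-≤ (sum-nonneg (λ i → g i * g i) (λ i → 0≤x² (g i)))
                (≤-respʳ (-‿inverseʳ _) (+-monoˡ-≤ (- a₀) (μ≤a zero)))))))))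
        where
        a₀ = a zero
        a′ = a ∘ suc
        t = product λ j → a′ j - a₀
        g = shifts L a′ f
        h : Fin n → Carrier
        h i = t * f i + - 1# * g i
        Lg≈a₀g : ∀ i → (L ⊛ g) i ≈ a₀ * g i
        Lg≈a₀g i = sym (x-y≈0⇒x≈y (trans (shift-shifts a′ a₀ f i) (annihilated i)))
        shifts-g : ∀ i → shifts L a′ g i ≈ t * g i
        shifts-g = shifts-eigen a′ a₀ Lg≈a₀g
        t⟨f,g⟩ : t * ⟨ f , g ⟩ ≈ ⟨ g , g ⟩
        t⟨f,g⟩ = begin
          t * ⟨ f , g ⟩            ≈⟨ ⟨,⟩-*ʳ t f g ⟨
          ⟨ f , (λ i → t * g i) ⟩  ≈⟨ ⟨,⟩-congʳ f shifts-g ⟨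
          ⟨ f , shifts L a′ g ⟩    ≈⟨ shifts-selfAdjoint a′ f g ⟨
          ⟨ g , g ⟩                ∎
        h-annihilated : ∀ i → shifts L a′ h i ≈ 0#
        h-annihilated i = begin
          shifts L a′ h i                    ≈⟨ shifts-combination a′ t (- 1#) f g i ⟩
          t * g i + - 1# * shifts L a′ g i   ≈⟨ +-congˡ (*-congˡ (shifts-g i)) ⟩
          t * g i + - 1# * (t * g i)         ≈⟨ solve 1 (λ x → x :+ con -[1+ 0 ] :* x := con (+ 0)) refl _ ⟩
          0#                                 ∎
        B : (Fin n → Carrier) → (Fin n → Carrier) → Carrier
        B u v = ⟨ u , shift L μ v ⟩
        B-g : ∀ u → B u g ≈ (μ - a₀) * ⟨ u , g ⟩
        B-g u = trans (⟨,⟩-congʳ u (shift-eigen μ a₀ Lg≈a₀g)) (⟨,⟩-*ʳ (μ - a₀) u g)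
        B-gf : B g f ≈ B f g
        B-gf = trans (⟨,⟩-comm g (shift L μ f)) (shift-selfAdjoint μ f g)
        B-hʳ : ∀ u → B u h ≈ t * B u f + - 1# * B u g
        B-hʳ u = trans (⟨,⟩-congʳ u (shift-combination μ t (- 1#) f g))
          (⟨,⟩-combinationʳ t (- 1#) u (shift L μ f) (shift L μ g))
        -- From t f = h + g, with g an eigenvector, every cross term is a multiple of ⟨h, g⟩ = t ⟨f,
        -- g⟩ - ⟨g, g⟩ = 0. Scaling by `t * t` takes the place of dividing the decomposition by `t`.
        t²-expansion : t * t * B f f ≈ B h h + (μ - a₀) * ⟨ g , g ⟩
        t²-expansion = sym (begin
          B h h + δ * ⟨ g , g ⟩
            ≈⟨ +-congʳ (⟨,⟩-combinationˡ t (- 1#) (shift L μ h) f g) ⟩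
          (t * B f h + - 1# * B g h) + δ * ⟨ g , g ⟩
            ≈⟨ +-congʳ (+-cong (*-congˡ (B-hʳ f)) (*-congˡ (B-hʳ g))) ⟩
          (t * (t * B f f + - 1# * B f g) + - 1# * (t * B g f + - 1# * B g g)) + δ * ⟨ g , g ⟩
            ≈⟨ +-congʳ (+-congˡ (*-congˡ (+-cong (*-congˡ B-gf) (*-congˡ (B-g g))))) ⟩
          (t * (t * B f f + - 1# * B f g) + - 1# * (t * B f g + - 1# * (δ * ⟨ g , g ⟩))) + δ * ⟨ g , g ⟩
            ≈⟨ +-congʳ (+-cong (*-congˡ (+-congˡ (*-congˡ (B-g f)))) (*-congˡ (+-congʳ (*-congˡ (B-g f))))) ⟩
          (t * (t * B f f + - 1# * (δ * ⟨ f , g ⟩)) +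
            - 1# * (t * (δ * ⟨ f , g ⟩) + - 1# * (δ * ⟨ g , g ⟩))) + δ * ⟨ g , g ⟩
            ≈⟨ solve 5 (λ t b d x y →
                 (t :* (t :* b :+ con -[1+ 0 ] :* (d :* x)) :+
                   con -[1+ 0 ] :* (t :* (d :* x) :+ con -[1+ 0 ] :* (d :* y))) :+ d :* y
                 := t :* t :* b :+ con (+ 2) :* d :* (y :- t :* x)) refl t (B f f) δ _ _ ⟩
          t * t * B f f + (1# + 1#) * δ * (⟨ g , g ⟩ - t * ⟨ f , g ⟩)
            ≈⟨ +-congˡ (trans (*-congˡ (x≈y⇒x-y≈0 (sym t⟨f,g⟩))) (zeroʳ _)) ⟩
          t * t * B f f + 0#
            ≈⟨ +-identityʳ _ ⟩
          t * t * B f f ∎)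
          where δ = μ - a₀

  product-#0 : (a : Fin m → Carrier) → (∀ i → a i # 0#) → product a # 0#
  product-#0 {zero}  a a#0 = #-sym (<⇒# 0<1)
  product-#0 {suc m} a a#0 = x#0y#0→xy#0 (a#0 zero) (product-#0 (a ∘ suc) (a#0 ∘ suc))

  module _ {n} (L : Matrix ℝ (suc n)) (L-sym : ∀ i j → L i j ≈ L j i)
    (L1≈0 : ∀ i → (L ⊛ (λ _ → 1#)) i ≈ 0#)
    (kernel-constant : ∀ {g} → (∀ i → (L ⊛ g) i ≈ 0#) → ∀ i j → g i ≈ g j)
    (ev : Fin (suc n) → Carrier) (roots : ∀ x → charPoly ℝ L x ≈ product λ i → x - ev i)
    where

    -- The product `g` of the later factors applied to `f` lies in the kernel of `L`, hence is
    -- constant, yet it is orthogonal to the constants because `f` is; so `g` vanishes. Positivity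
    -- of `μ` keeps the later eigenvalues apart from zero.
    fiedler-bound : ∀ μ → 0# < μ → (∀ i → μ ≤ ev (suc i)) → ∀ f → ⟨ f , (λ _ → 1#) ⟩ ≈ 0# →
      ⟨ f , shift L μ f ⟩ ≤ 0#
    fiedler-bound μ 0<μ μ≤ev f f⊥1 =
      rayleigh-lower-bound L L-sym ev′ μ μ≤ev f (⟨f,f⟩≈0⇒f≈0 g ⟨g,g⟩≈0)
      where
      one : Fin (suc n) → Carrier
      one _ = 1#
      ev′ : Fin n → Carrier
      ev′ = ev ∘ suc
      t = product λ i → ev′ i - 0#
      g = shifts L ev′ f
      1-eigen : ∀ i → (L ⊛ one) i ≈ 0# * 1#
      1-eigen i = trans (L1≈0 i) (sym (zeroˡ 1#))
      t#0 : t # 0#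
      t#0 = product-#0 (λ i → ev′ i - 0#) λ i → #-congʳ (sym (x-0≈x (ev′ i))) (#-sym (<⇒# (<-≤-trans 0<μ (μ≤ev i))))
      -- The first eigenvalue is not assumed to be zero. Cayley-Hamilton on the constant vector
      -- makes the product of all eigenvalues vanish, and all but the first are invertible.
      ev₀≈0 : ev zero ≈ 0#
      ev₀≈0 = #0-cancel t#0 (begin
        t * ev zero
          ≈⟨ solve 2 (λ t e → t :* e := (e :- con (+ 0)) :* t :* con (+ 1)) refl t (ev zero) ⟩
        (ev zero - 0#) * t * 1#           ≈⟨ shifts-eigen L ev 0# 1-eigen zero ⟨
        shifts L ev one zero              ≈⟨ cayley-hamilton L ev roots one zero ⟩
        0#                                ∎)
      Lg≈0 : ∀ i → (L ⊛ g) i ≈ 0#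
      Lg≈0 i = trans (sym (x-y≈0⇒x≈y (trans (shift-shifts L ev′ (ev zero) f i) (cayley-hamilton L ev roots f i))))
        (trans (*-congʳ ev₀≈0) (zeroˡ _))
      ⟨g,1⟩≈0 : ⟨ g , one ⟩ ≈ 0#
      ⟨g,1⟩≈0 = begin
        ⟨ g , one ⟩               ≈⟨ shifts-selfAdjoint L L-sym ev′ f one ⟩
        ⟨ f , shifts L ev′ one ⟩  ≈⟨ ⟨,⟩-congʳ f (shifts-eigen L ev′ 0# 1-eigen) ⟩
        ⟨ f , (λ _ → t * 1#) ⟩    ≈⟨ ⟨,⟩-*ʳ t f one ⟩
        t * ⟨ f , one ⟩           ≈⟨ *-congˡ f⊥1 ⟩
        t * 0#                    ≈⟨ zeroʳ t ⟩
        0#                        ∎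
      ⟨g,g⟩≈0 : ⟨ g , g ⟩ ≈ 0#
      ⟨g,g⟩≈0 = begin
        ⟨ g , g ⟩
          ≈⟨ ⟨,⟩-congʳ g (λ i → trans (kernel-constant {g} Lg≈0 i zero) (sym (*-identityʳ _))) ⟩
        ⟨ g , (λ _ → g zero * 1#) ⟩   ≈⟨ ⟨,⟩-*ʳ (g zero) g one ⟩
        g zero * ⟨ g , one ⟩          ≈⟨ *-congˡ ⟨g,1⟩≈0 ⟩
        g zero * 0#                   ≈⟨ zeroʳ _ ⟩
        0#                            ∎

  -- The hypergraph Laplacian

  ind : ∀ {p} {P : Set p} → Dec P → Carrier
  ind d = if does d then 1# else 0#

  0≤ind : ∀ {p} {P : Set p} (d : Dec P) → 0# ≤ ind d
  0≤ind (yes _) = <⇒≤ 0<1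
  0≤ind (no  _) = ≤-refl

  sum-ind-∈ : (p : Subset n) → sum (λ j → ind (j ∈? p)) ≈ fromℕ ∣ p ∣
  sum-ind-∈ Vec.[] = refl
  sum-ind-∈ (inside Vec.∷ p) = +-congˡ (sum-ind-∈ p)
  sum-ind-∈ (outside Vec.∷ p) = trans (+-identityˡ _) (sum-ind-∈ p)

  weight : Subset n → Carrier
  weight e = 1/ℕ (∣ e ∣ ∸ 1)

  -- The off-diagonal formula of the adjacency matrix, continued to the diagonal. Without the test
  -- for `i ≡ j` it can be analysed by recursion on the list of edges.
  weights : List (Subset n) → Fin n → Fin n → Carrier
  weights es i j = foldr (λ e s → weight e + s) 0# (filter (λ e → (i ∈? e) ×-dec (j ∈? e)) es)

  0<weight : {e : Subset n} → 2 ℕ.≤ ∣ e ∣ → 0# < weight e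
  0<weight {e = e} 2≤e with ∣ e ∣
  0<weight (s≤s (s≤s _)) | suc (suc k) = 0<1/ℕ k

  weights-∷ : (e : Subset n) (es : List (Subset n)) → ∀ i j →
    weights (e ∷ es) i j ≈ ind (i ∈? e) * ind (j ∈? e) * weight e + weights es i j
  weights-∷ e es i j with i ∈? e | j ∈? e
  ... | yes _ | yes _ = +-congʳ (solve 1 (λ w → w := con (+ 1) :* con (+ 1) :* w) refl _)
  ... | yes _ | no  _ = solve 2 (λ w s → s := con (+ 1) :* con (+ 0) :* w :+ s) refl (weight e) _
  ... | no  _ | yes _ = solve 2 (λ w s → s := con (+ 0) :* con (+ 1) :* w :+ s) refl (weight e) _
  ... | no  _ | no  _ = solve 2 (λ w s → s := con (+ 0) :* con (+ 0) :* w :+ s) refl (weight e) _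

  module _ {i j : Fin n} where

    0≤weights : ∀ {es} → All (λ e → 2 ℕ.≤ ∣ e ∣) es → 0# ≤ weights es i j
    0≤weights [] = ≤-refl
    0≤weights {e ∷ es} (2≤e ∷ 2≤es) = ≤-respʳ (sym (weights-∷ e es i j)) (≤-respˡ (+-identityˡ 0#)
      (+-mono-≤ (*-nonneg (*-nonneg (0≤ind (i ∈? e)) (0≤ind (j ∈? e))) (<⇒≤ (0<weight {e = e} 2≤e)))
        (0≤weights 2≤es)))

    0<weights : ∀ {es} → All (λ e → 2 ℕ.≤ ∣ e ∣) es → Any (λ e → i ∈ e × j ∈ e) es → 0# < weights es i j
    0<weights {e ∷ es} (2≤e ∷ 2≤es) (here (i∈e , j∈e)) with i ∈? e | j ∈? e
    ... | yes _ | yes _ = <-≤-trans (0<weight {e = e} 2≤e)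
      (≤-respˡ (+-identityʳ _) (+-mono-≤ ≤-refl (0≤weights 2≤es)))
    ... | no i∉e | _     = contradiction i∈e i∉e
    ... | yes _  | no j∉e = contradiction j∈e j∉e
    0<weights {e ∷ es} (2≤e ∷ 2≤es) (there any) = <-≤-trans (0<weights 2≤es any)
      (≤-respʳ (sym (weights-∷ e es i j)) (≤-respˡ (+-identityˡ _)
        (+-mono-≤ (*-nonneg (*-nonneg (0≤ind (i ∈? e)) (0≤ind (j ∈? e))) (<⇒≤ (0<weight {e = e} 2≤e))) ≤-refl)))

    weights≈0 : ∀ es → ¬ Any (λ e → i ∈ e × j ∈ e) es → weights es i j ≈ 0#
    weights≈0 [] _ = refl
    weights≈0 (e ∷ es) avoids with i ∈? e | j ∈? e
    ... | yes i∈e | yes j∈e = contradiction (here (i∈e , j∈e)) avoids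
    ... | yes _   | no _    = weights≈0 es (avoids ∘ there)
    ... | no _    | yes _   = weights≈0 es (avoids ∘ there)
    ... | no _    | no _    = weights≈0 es (avoids ∘ there)

    -- Here `k` + 2 plays the role of the co-rank: every edge then weighs at most 1/(k + 1).
    weights-bound : ∀ k {es} → All (λ e → suc (suc k) ℕ.≤ ∣ e ∣) es →
      weights es i j ≤ fromℕ (length (filter (λ e → (i ∈? e) ×-dec (j ∈? e)) es)) * 1/ℕ (suc k)
    weights-bound k [] = ≤-reflexive (sym (zeroˡ _))
    weights-bound k {e ∷ es} (k≤e ∷ k≤es) with i ∈? e | j ∈? e
    ... | yes _ | yes _ = ≤-respʳ (solve 2 (λ f w → w :+ f :* w := (con (+ 1) :+ f) :* w) refl _ _)
      (+-mono-≤ (weight≤ k≤e) (weights-bound k k≤es))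
      where
      weight≤ : suc (suc k) ℕ.≤ ∣ e ∣ → weight e ≤ 1/ℕ (suc k)
      weight≤ k≤e with ∣ e ∣
      weight≤ (s≤s (s≤s k≤l)) | suc (suc l) = *-cancel-≤ (0<fromℕ k)
        (≤-respʳ (sym (fromℕ*1/ℕ k)) (fromℕ*1/ℕ≤1 (s≤s k≤l)))
    ... | yes _ | no  _ = weights-bound k k≤es
    ... | no  _ | yes _ = weights-bound k k≤es
    ... | no  _ | no  _ = weights-bound k k≤es

  weights-sym : (es : List (Subset n)) → ∀ i j → weights es i j ≈ weights es j i
  weights-sym es i j = reflexive (≡.cong (foldr (λ e s → weight e + s) 0#)
    (List.filter-≐ (λ e → (i ∈? e) ×-dec (j ∈? e)) (λ e → (j ∈? e) ×-dec (i ∈? e))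
      ((λ (p , q) → q , p) , (λ (p , q) → q , p)) es))

  offDiagonal : Fin n → Fin n → Carrier
  offDiagonal i j = 1# - basis i j

  -- An edge `e` through `i` has ∣e∣ - 1 other vertices and gives each the weight 1/(∣e∣ - 1), so it
  -- adds exactly one. Row sums of the adjacency matrix are thus degrees, which is why the Laplacian
  -- kills constants.
  weights-row-sum : ∀ {es : List (Subset n)} → All (λ e → 2 ℕ.≤ ∣ e ∣) es → ∀ i →
    sum (λ j → offDiagonal i j * weights es i j) ≈ fromℕ (length (filter (i ∈?_) es))
  weights-row-sum [] i = sum-zero (λ j → offDiagonal i j * 0#) λ j → zeroʳ (offDiagonal i j)
  weights-row-sum {es = e ∷ es} (2≤e ∷ 2≤es) i = begin
    sum (λ j → offDiagonal i j * weights (e ∷ es) i j)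
      ≈⟨ sum-cong-≋ (λ j → trans (*-congˡ (weights-∷ e es i j))
           (solve 5 (λ d x y w r → d :* (x :* y :* w :+ r) := x :* w :* (d :* y) :+ d :* r)
             refl (offDiagonal i j) (ind (i ∈? e)) (ind (j ∈? e)) (weight e) (weights es i j))) ⟩
    sum (λ j → ind (i ∈? e) * weight e * (offDiagonal i j * ind (j ∈? e)) + offDiagonal i j * weights es i j)
      ≈⟨ sum-linear (ind (i ∈? e) * weight e) (λ j → offDiagonal i j * ind (j ∈? e)) _ ⟩
    ind (i ∈? e) * weight e * sum (λ j → offDiagonal i j * ind (j ∈? e)) +
      sum (λ j → offDiagonal i j * weights es i j)
      ≈⟨ +-cong (*-congˡ row) (weights-row-sum 2≤es i) ⟩
    ind (i ∈? e) * weight e * (fromℕ ∣ e ∣ - ind (i ∈? e)) + fromℕ (length (filter (i ∈?_) es))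
      ≈⟨ count ⟩
    fromℕ (length (filter (i ∈?_) (e ∷ es))) ∎
    where
    row : sum (λ j → offDiagonal i j * ind (j ∈? e)) ≈ fromℕ ∣ e ∣ - ind (i ∈? e)
    row = begin
      sum (λ j → offDiagonal i j * ind (j ∈? e))
        ≈⟨ sum-cong-≋ (λ j → solve 2 (λ b x → (con (+ 1) :- b) :* x := con -[1+ 0 ] :* (b :* x) :+ x)
             refl (basis i j) (ind (j ∈? e))) ⟩
      sum (λ j → - 1# * (basis i j * ind (j ∈? e)) + ind (j ∈? e))
        ≈⟨ sum-linear (- 1#) (λ j → basis i j * ind (j ∈? e)) _ ⟩
      - 1# * sum (λ j → basis i j * ind (j ∈? e)) + sum (λ j → ind (j ∈? e))
        ≈⟨ +-cong (*-congˡ (sum-single _ i λ j j≢i → trans (*-congʳ (diagonal-other _ (j≢i ∘ ≡.sym))) (zeroˡ _)))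
             (sum-ind-∈ e) ⟩
      - 1# * (basis i i * ind (i ∈? e)) + fromℕ ∣ e ∣
        ≈⟨ +-congʳ (*-congˡ (*-congʳ (diagonal-same _ i))) ⟩
      - 1# * (1# * ind (i ∈? e)) + fromℕ ∣ e ∣
        ≈⟨ solve 2 (λ x y → con -[1+ 0 ] :* (con (+ 1) :* x) :+ y := y :- x) refl _ _ ⟩
      fromℕ ∣ e ∣ - ind (i ∈? e) ∎
    unit : 2 ℕ.≤ ∣ e ∣ → 1# * weight e * (fromℕ ∣ e ∣ - 1#) ≈ 1#
    unit 2≤e with ∣ e ∣
    unit (s≤s (s≤s _)) | suc (suc k) = trans
      (solve 2 (λ w f → con (+ 1) :* w :* (con (+ 1) :+ f :- con (+ 1)) := f :* w) refl _ _) (fromℕ*1/ℕ k)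
    count : ind (i ∈? e) * weight e * (fromℕ ∣ e ∣ - ind (i ∈? e)) + fromℕ (length (filter (i ∈?_) es)) ≈
      fromℕ (length (filter (i ∈?_) (e ∷ es)))
    count with i ∈? e
    ... | yes _ = +-congʳ (unit 2≤e)
    ... | no  _ = solve 3 (λ w f r → con (+ 0) :* w :* f :+ r := r) refl _ _ _

  module _ (G : Hypergraph n) where
    open Hypergraph G

    A : Matrix ℝ n
    A = adjacencyMatrix ℝ G

    L : Matrix ℝ n
    L = laplacian ℝ G

    A-off : ∀ {i j} → i ≢ j → A i j ≈ weights edges i j
    A-off {i} {j} i≢j with i Fin.≟ j
    ... | yes i≡j = contradiction i≡j i≢j
    ... | no _    = refl

    A-offDiagonal : ∀ i j → A i j ≈ offDiagonal i j * weights edges i j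
    A-offDiagonal i j with i Fin.≟ j
    ... | yes _ = solve 1 (λ w → con (+ 0) := (con (+ 1) :- con (+ 1)) :* w) refl _
    ... | no _  = solve 1 (λ w → w := (con (+ 1) :- con (+ 0)) :* w) refl _

    A-row-sum : ∀ i → sum (A i) ≈ fromℕ (degree G i)
    A-row-sum i = trans (sum-cong-≋ (A-offDiagonal i)) (weights-row-sum edgeSize≥2 i)

    0≤A : ∀ i j → 0# ≤ A i j
    0≤A i j with i Fin.≟ j
    ... | yes _ = ≤-refl
    ... | no _  = 0≤weights edgeSize≥2

    A-sym : ∀ i j → A i j ≈ A j i
    A-sym i j with i Fin.≟ j
    ... | yes ≡.refl = sym (trans (A-offDiagonal i i)
      (trans (*-congʳ (trans (+-congˡ (-‿cong (diagonal-same _ i))) (-‿inverseʳ 1#))) (zeroˡ _)))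
    ... | no i≢j = trans (weights-sym edges i j) (sym (A-off (i≢j ∘ ≡.sym)))

    L-sym : ∀ i j → L i j ≈ L j i
    L-sym i j = +-cong (diagonal-sym i j) (-‿cong (A-sym i j))
      where
      diagonal-sym : ∀ i j → degreeMatrix ℝ G i j ≈ degreeMatrix ℝ G j i
      diagonal-sym i j with i Fin.≟ j
      ... | yes ≡.refl = sym (diagonal-same _ i)
      ... | no i≢j     = sym (diagonal-other _ (i≢j ∘ ≡.sym))

    L-⊛ : ∀ f i → (L ⊛ f) i ≈ sum λ j → A i j * (f i - f j)
    L-⊛ f i = begin
      sum (λ j → (degreeMatrix ℝ G i j - A i j) * f j)
        ≈⟨ sum-cong-≋ (λ j → solve 3 (λ d a x → (d :- a) :* x := con -[1+ 0 ] :* (a :* x) :+ d :* x)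
             refl _ (A i j) (f j)) ⟩
      sum (λ j → - 1# * (A i j * f j) + degreeMatrix ℝ G i j * f j)
        ≈⟨ sum-linear (- 1#) (λ j → A i j * f j) _ ⟩
      - 1# * (A ⊛ f) i + sum (λ j → degreeMatrix ℝ G i j * f j)
        ≈⟨ +-congˡ (sum-single _ i λ j j≢i → trans (*-congʳ (diagonal-other _ (j≢i ∘ ≡.sym))) (zeroˡ _)) ⟩
      - 1# * (A ⊛ f) i + degreeMatrix ℝ G i i * f i
        ≈⟨ +-congˡ (trans (*-congʳ (trans (diagonal-same _ i) (sym (A-row-sum i)))) (*-comm _ _)) ⟩
      - 1# * (A ⊛ f) i + f i * sum (A i)
        ≈⟨ sum-combination (- 1#) (f i) (λ j → A i j * f j) (A i) ⟨
      sum (λ j → - 1# * (A i j * f j) + f i * A i j)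
        ≈⟨ sum-cong-≋ (λ j → solve 3 (λ a x y → con -[1+ 0 ] :* (a :* y) :+ x :* a := a :* (x :- y))
             refl (A i j) (f i) (f j)) ⟩
      sum (λ j → A i j * (f i - f j)) ∎

    L1≈0 : ∀ i → (L ⊛ (λ _ → 1#)) i ≈ 0#
    L1≈0 i = trans (L-⊛ (λ _ → 1#) i)
      (sum-zero (λ j → A i j * (1# - 1#)) λ j → trans (*-congˡ (-‿inverseʳ 1#)) (zeroʳ (A i j)))

    -- Left unsymmetrised on purpose: rows where `f` vanishes drop out, so in the upper bound each
    -- pair of a cut vertex and an outside vertex counts once.
    ⟨f,Lf⟩ : ∀ f → ⟨ f , L ⊛ f ⟩ ≈ sum λ i → sum λ j → A i j * (f i * (f i - f j))
    ⟨f,Lf⟩ f = sum-cong-≋ λ i → begin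
      f i * (L ⊛ f) i                           ≈⟨ *-congˡ (L-⊛ f i) ⟩
      f i * sum (λ j → A i j * (f i - f j))     ≈⟨ *-distribˡ-sum (f i) (λ j → A i j * (f i - f j)) ⟩
      sum (λ j → f i * (A i j * (f i - f j)))
        ≈⟨ sum-cong-≋ (λ j → solve 3 (λ x a y → x :* (a :* y) := a :* (x :* y))
             refl (f i) (A i j) (f i - f j)) ⟩
      sum (λ j → A i j * (f i * (f i - f j)))   ∎

    -- Each difference squared splits into the contributions of the two orders of the pair, hence
    -- the factor two. In this form all terms are nonnegative.
    dirichlet : ∀ f → sum (λ i → sum λ j → A i j * ((f i - f j) * (f i - f j))) ≈ fromℕ 2 * ⟨ f , L ⊛ f ⟩
    dirichlet f = begin
      sum (λ i → sum λ j → A i j * ((f i - f j) * (f i - f j)))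
        ≈⟨ sum-cong-≋ (λ i → trans (sum-cong-≋ λ j → trans
             (solve 3 (λ a x y → a :* ((x :- y) :* (x :- y)) := a :* (x :* (x :- y)) :+ a :* (y :* (y :- x)))
               refl (A i j) (f i) (f j)) (+-congˡ (*-congʳ (A-sym i j))))
             (∑-distrib-+ (λ j → E i j) (λ j → E j i))) ⟩
      sum (λ i → sum (λ j → E i j) + sum (λ j → E j i))
        ≈⟨ ∑-distrib-+ (λ i → sum λ j → E i j) (λ i → sum λ j → E j i) ⟩
      Q + sum (λ i → sum λ j → E j i)
        ≈⟨ +-congˡ (∑-comm (λ i j → E j i)) ⟩
      Q + Q
        ≈⟨ solve 1 (λ q → q :+ q := (con (+ 1) :+ (con (+ 1) :+ con (+ 0))) :* q) refl Q ⟩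
      fromℕ 2 * Q
        ≈⟨ *-congˡ (⟨f,Lf⟩ f) ⟨
      fromℕ 2 * ⟨ f , L ⊛ f ⟩ ∎
      where
      E : Fin n → Fin n → Carrier
      E i j = A i j * (f i * (f i - f j))
      Q = sum λ i → sum λ j → E i j

    -- A kernel vector has zero energy, so each nonnegative term vanishes. Across an edge the matrix
    -- entry is positive, which forces equal values, and paths spread this over the graph.
    kernel-constant : Connected G → ∀ {g} → (∀ i → (L ⊛ g) i ≈ 0#) → ∀ i j → g i ≈ g j
    kernel-constant conn {g} Lg≈0 i j = along (conn i j)
      where
      energy : Fin n → Fin n → Carrier
      energy i j = A i j * ((g i - g j) * (g i - g j))
      0≤energy : ∀ i j → 0# ≤ energy i j
      0≤energy i j = *-nonneg (0≤A i j) (0≤x² _)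
      energy≈0 : ∀ i j → energy i j ≈ 0#
      energy≈0 i = sum≈0⇒≈0 (energy i) (0≤energy i)
        (sum≈0⇒≈0 (λ i → sum (energy i)) (λ i → sum-nonneg (energy i) (0≤energy i))
          (trans (dirichlet g) (trans (*-congˡ (sum-zero _ λ i → trans (*-congˡ (Lg≈0 i)) (zeroʳ _))) (zeroʳ _))) i)
      along : ∀ {i j} → Path setSystem i j → g i ≈ g j
      along ε = refl
      along (_◅_ {i} {k} (i≢k , any) path) = trans
        (x-y≈0⇒x≈y (x²≈0⇒x≈0 (#0-cancel
          (#-congʳ (sym (A-off i≢k)) (#-sym (<⇒# (0<weights edgeSize≥2 any)))) (energy≈0 i k))))
        (along path)

    degree≤maxDegree : ∀ i → degree G i ℕ.≤ maxDegree G
    degree≤maxDegree i = All.lookup (xs≤max 0 (List.map (degree G) (List.allFin n))) (∈-map⁺ (degree G) (∈-allFin i))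

    coRank≤ : All (λ e → coRank G ℕ.≤ ∣ e ∣) edges
    coRank≤ = All.map⁻ (min≤xs n (List.map ∣_∣ edges))

    A≤1 : maxDegree G ℕ.≤ coRank G → ∀ {i s} → i ≢ s →
      length (filter (λ e → (i ∈? e) ×-dec (s ∈? e)) edges) ℕ.< degree G s → A i s ≤ 1#
    A≤1 Δ≤r {i} {s} i≢s codegree<degree = ≤-respˡ (sym (A-off i≢s)) (bound (coRank G) coRank≤
        (ℕ.<-≤-trans codegree<degree (ℕ.≤-trans (degree≤maxDegree s) Δ≤r)))
      where
      codegree : ℕ
      codegree = length (filter (λ e → (i ∈? e) ×-dec (s ∈? e)) edges)
      bound : ∀ r → All (λ e → r ℕ.≤ ∣ e ∣) edges → codegree ℕ.< r → weights edges i s ≤ 1#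
      -- For r = 1 no edge is shared, and edge sizes of at least 2 suffice; r = 0 is excluded by the
      -- strict inequality. From r = k + 2 on, at most k + 1 edges of weight at most 1/(k + 1) are
      -- shared.
      bound (suc zero) _ (s≤s codegree≤0) = ≤-trans (weights-bound 0 edgeSize≥2)
        (fromℕ*1/ℕ≤1 {k = 0} (ℕ.≤-trans codegree≤0 z≤n))
      bound (suc (suc k)) r≤ (s≤s codegree≤k) = ≤-trans (weights-bound k r≤) (fromℕ*1/ℕ≤1 codegree≤k)

    -- The test vector of a minimum weak cut

    module _ (Δ≤r : maxDegree G ℕ.≤ coRank G) (conn : Connected G) {S : Subset n} (S-cut : IsWeakCut G S)
      (S-min : ∀ T → IsWeakCut G T → ∣ S ∣ ℕ.≤ ∣ T ∣) (sep : Separation G S) where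
      open Separation sep

      sideSize : Side → Carrier
      sideSize t = sum λ i → ind (side i ≟ˢ t)

      sideValue : Side → Carrier
      sideValue cut   = 0#
      sideValue left  = sideSize right
      sideValue right = - sideSize left

      testVector : Fin n → Carrier
      testVector i = sideValue (side i)

      0<sideSize : ∀ t → t ≢ cut → 0# < sideSize t
      0<sideSize t t≢cut with nonempty t t≢cut
      ... | i , ≡.refl = <-≤-trans 0<1 (≤-respˡ (ind-refl (side i))
        (term≤sum (λ j → ind (side j ≟ˢ side i)) (λ j → 0≤ind (side j ≟ˢ side i)) i))
        where
        ind-refl : ∀ t → ind (t ≟ˢ t) ≈ 1#
        ind-refl cut   = refl
        ind-refl left  = refl
        ind-refl right = refl

      testVector⊥1 : ⟨ testVector , (λ _ → 1#) ⟩ ≈ 0#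
      testVector⊥1 = begin
        ⟨ testVector , (λ _ → 1#) ⟩
          ≈⟨ sum-cong-≋ (λ i → split (side i)) ⟩
        sum (λ i → sideSize right * ind (side i ≟ˢ left) + - sideSize left * ind (side i ≟ˢ right))
          ≈⟨ sum-combination (sideSize right) (- sideSize left)
               (λ i → ind (side i ≟ˢ left)) (λ i → ind (side i ≟ˢ right)) ⟩
        sideSize right * sideSize left + - sideSize left * sideSize right
          ≈⟨ solve 2 (λ a b → b :* a :+ (:- a) :* b := con (+ 0)) refl (sideSize left) (sideSize right) ⟩
        0# ∎
        where
        split : ∀ t → sideValue t * 1# ≈ sideSize right * ind (t ≟ˢ left) + - sideSize left * ind (t ≟ˢ right)
        split cut   = solve 2 (λ a b → con (+ 0) :* con (+ 1) := b :* con (+ 0) :+ (:- a) :* con (+ 0)) refl _ _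
        split left  = solve 2 (λ a b → b :* con (+ 1) := b :* con (+ 1) :+ (:- a) :* con (+ 0)) refl _ _
        split right = solve 2 (λ a b → (:- a) :* con (+ 1) := b :* con (+ 0) :+ (:- a) :* con (+ 1)) refl _ _

      0<⟨testVector,testVector⟩ : 0# < ⟨ testVector , testVector ⟩
      0<⟨testVector,testVector⟩ with nonempty left (λ ())
      ... | i , i-left = <-≤-trans
        (<-respʳ (reflexive (≡.cong (λ t → sideValue t * sideValue t) (≡.sym i-left)))
          (*-pos (0<sideSize right λ ()) (0<sideSize right λ ())))
        (term≤sum (λ i → testVector i * testVector i) (λ i → 0≤x² (testVector i)) i)

      -- The vector is zero on `S`, so rows in `S` vanish. Two vertices outside `S` have equal
      -- values or share no edge. There remain `i` outside and `j` inside `S`, where the term is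
      -- `A i j` times the square of the value at `i`.
      term-bound : ∀ i j → A i j * (testVector i * (testVector i - testVector j)) ≤
        testVector i * testVector i * ind (j ∈? S)
      term-bound i j with side i ≟ˢ cut
      ... | yes i-cut = ≤-reflexive (trans
        (*-congˡ (trans (*-congʳ f≈0) (zeroˡ _)))
        (trans (zeroʳ _) (sym (trans (*-congʳ (trans (*-congʳ f≈0) (zeroˡ _))) (zeroˡ _)))))
        where
        f≈0 : testVector i ≈ 0#
        f≈0 = reflexive (≡.cong sideValue i-cut)
      ... | no i∉cut with j ∈? S
      ...   | yes j∈S = ≤-respˡ (*-comm _ _) (≤-respˡ (*-congʳ (*-congˡ (sym (f-j≈f))))
                (*-monoʳ-≤ (0≤x² (testVector i)) (A≤1 Δ≤r i≢j (codegree<degree G conn S-cut S-min sep i∉cut j∈S))))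
        where
        i≢j : i ≢ j
        i≢j i≡j = i∉cut (≡.trans (≡.cong side i≡j) (∈⇒cut j∈S))
        f-j≈f : testVector i - testVector j ≈ testVector i
        f-j≈f = trans (+-congˡ (-‿cong (reflexive (≡.cong sideValue (∈⇒cut j∈S))))) (x-0≈x _)
      ...   | no j∉S = ≤-reflexive (trans (by-side (side i ≟ˢ side j)) (sym (zeroʳ _)))
        where
        by-side : Dec (side i ≡ side j) → A i j * (testVector i * (testVector i - testVector j)) ≈ 0#
        by-side (yes same) = trans
          (*-congˡ (trans (*-congˡ (x≈y⇒x-y≈0 (reflexive (≡.cong sideValue same)))) (zeroʳ _)))
          (zeroʳ _)
        by-side (no differ) = trans (*-congʳ (trans (A-off (differ ∘ ≡.cong side)) (weights≈0 edges λ any →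
          let e , e∈ , i∈e , j∈e = find any in
          differ (same-side e∈ i∈e j∈e i∉cut (j∉S ∘ cut⇒∈))))) (zeroˡ _)

      rayleigh-upper-bound : ⟨ testVector , L ⊛ testVector ⟩ ≤ fromℕ ∣ S ∣ * ⟨ testVector , testVector ⟩
      rayleigh-upper-bound = ≤-respˡ (sym (⟨f,Lf⟩ testVector)) (≤-respʳ total
        (sum-mono-≤ _ (λ i → sum λ j → testVector i * testVector i * ind (j ∈? S))
          λ i → sum-mono-≤ _ (λ j → testVector i * testVector i * ind (j ∈? S)) (term-bound i)))
        where
        total : sum (λ i → sum λ j → testVector i * testVector i * ind (j ∈? S)) ≈
          fromℕ ∣ S ∣ * ⟨ testVector , testVector ⟩
        total = trans
          (sum-cong-≋ λ i → trans (sym (*-distribˡ-sum (testVector i * testVector i) (λ j → ind (j ∈? S))))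
            (trans (*-congˡ (sum-ind-∈ S)) (*-comm (testVector i * testVector i) (fromℕ ∣ S ∣))))
          (sym (*-distribˡ-sum (fromℕ ∣ S ∣) (λ i → testVector i * testVector i)))

  λ₂≤∣cut∣ : (G : Hypergraph (suc (suc n))) → Connected G → maxDegree G ℕ.≤ coRank G →
    (ev : Fin (suc (suc n)) → Carrier) → IsOrderedSpectrum ℝ (laplacian ℝ G) ev →
    ∀ {S} → IsWeakCut G S → (∀ T → IsWeakCut G T → ∣ S ∣ ℕ.≤ ∣ T ∣) →
    ev (suc zero) ≤ fromℕ ∣ S ∣
  -- Since `_≤_` is a negation, `κ<μ` is the assumption to be refuted; it also supplies the
  -- positivity of `μ` that `fiedler-bound` requires.
  λ₂≤∣cut∣ G conn Δ≤r ev spectrum {S} S-cut S-min κ<μ = *-cancel-≤ 0<⟨f,f⟩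
    (≤-respˡ (*-comm _ _) (≤-respʳ (*-comm _ _) (≤-trans lower upper))) κ<μ
    where
    open IsOrderedSpectrum spectrum
    sep = weakCut⇒separation G zero S-cut
    f = testVector G Δ≤r conn S-cut S-min sep
    μ = ev (suc zero)
    ℒ = laplacian ℝ G
    0<⟨f,f⟩ : 0# < ⟨ f , f ⟩
    0<⟨f,f⟩ = 0<⟨testVector,testVector⟩ G Δ≤r conn S-cut S-min sep
    upper : ⟨ f , ℒ ⊛ f ⟩ ≤ fromℕ ∣ S ∣ * ⟨ f , f ⟩
    upper = rayleigh-upper-bound G Δ≤r conn S-cut S-min sep
    lower : μ * ⟨ f , f ⟩ ≤ ⟨ f , ℒ ⊛ f ⟩
    lower = ≤-respˡ
      (trans (+-congʳ (⟨,shift⟩ ℒ (L-sym G) μ f f))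
        (solve 2 (λ x y → x :+ con -[1+ 0 ] :* y :+ y := x) refl _ ⟨ f , ℒ ⊛ f ⟩))
      (≤-respʳ (+-identityˡ _) (+-monoˡ-≤ ⟨ f , ℒ ⊛ f ⟩
        (fiedler-bound ℒ (L-sym G) (L1≈0 G) (kernel-constant G conn) ev roots μ
          (≤-<-trans (0≤fromℕ ∣ S ∣) κ<μ) (λ i → ordered (s≤s z≤n)) f
          (testVector⊥1 G Δ≤r conn S-cut S-min sep))))

open import Data.Nat.Base using (_≤_)
open import Data.Nat.Properties using (<⇒≤)

theorem5 : {c ℓ₁ ℓ₂ : Level} (ℝ : Reals c ℓ₁ ℓ₂) (n : ℕ) (n≥3 : 3 ≤ n) (G : Hypergraph n) →
    Connected G →
    HasNonadjacentPair G →
    maxDegree G ≤ coRank G →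
    (ev : Fin n → Reals.Carrier ℝ) → IsOrderedSpectrum ℝ (laplacian ℝ G) ev →
    (κ : ℕ) → IsWeakConnectivity G κ →
    Reals._≤_ ℝ (ev (fromℕ< {1} (<⇒≤ n≥3))) (Reals.fromℕ ℝ κ)
-- Matching on the size bound makes the index of the second eigenvalue reduce to `suc zero`.
theorem5 ℝ _ (s≤s (s≤s (s≤s z≤n))) G conn _ Δ≤r ev spectrum _ ((S , S-cut , ≡.refl) , S-min) =
  OverReals.λ₂≤∣cut∣ ℝ G conn Δ≤r ev spectrum S-cut S-min
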